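{- For every typing context $\Gamma$, formula $A$ and term $u$ such that $\Gamma\vdash_{\mathtt{NI}^p}u:A$: (1) $\Gamma^*\vdash_{\mathtt{NI}^2_{at}}u^{*\downarrow}\rightsquigarrow_{\beta}u^{*\downarrow^{\varepsilon}}:A^*$; (2) $\Gamma^*\vdash_{\mathtt{NI}^2_{at}}u^{*\downarrow^{\varepsilon}}\rightsquigarrow_{\beta}u^{\sharp}:A^*$. Here $u^{*\downarrow}$ is the FF-atomization of the RP-translation of $u$, $u^{*\downarrow^\varepsilon}$ the $\varepsilon$-atomization of the RP-translation of $u$, and $u^\sharp$ the ESF-translation of $u$.
   Context: Notation for lists: for a finite (possibly empty) list $\mathcal A=\langle a_1,\dots,a_n\rangle$, $\langle A_a\rangle_{a\in\mathcal A}\supset B$ abbreviates $A_{a_1}\supset\dots\supset A_{a_n}\supset B$ (just $B$ if $\mathcal A$ is empty); $\lambda\langle x_a\rangle.t$ abbreviates $\lambda x_{a_1}\dots\lambda x_{a_n}.t$ and $t\langle u_a\rangle$ abbreviates $t\,u_{a_1}\cdots u_{a_n}$. Polynomial connectives. A polynomial connective $\dagger$ is given by finite (possibly empty) lists $\mathcal I,\mathcal J,\mathcal K$ and functions $f:\mathcal J\to\mathcal I$, $g:\mathcal J\to\mathcal K$; $g^{ -1}(k)$ is the sublist of the $j\in\mathcal J$ with $g(j)=k$. It forms a formula $\dagger\langle A_i\rangle_{i\in\mathcal I}$. Formulas. $\mathcal L^p$: $A::=X\mid A\supset B\mid\dagger\langle A_i\rangle$; $\mathcal L^2$: $A::=X\mid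 A\supset B\mid\forall X.A$. $\mathcal L^2_{RP}\subset\mathcal L^2$: $A::=X\mid A\supset B\mid\forall X.\langle\langle A_{f(j)}\rangle_{j\in g^{ -1}(k)}\supset X\rangle_{k\in\mathcal K}\supset X$ ($X$ not free in the $A_i$). System $\mathtt{NI}^p$ over $\mathcal L^p$: terms $t::=x\mid\lambda x.t\mid tu\mid\iota_\dagger^k\langle t_j\rangle_{j\in g^{ -1}(k)}\mid\delta_\dagger(t,\langle\langle y_j\rangle_{j\in g^{ -1}(k)}.s_k\rangle_{k\in\mathcal K})$, with the usual rules for variables, $\lambda$ and application, and: for each $k\in\mathcal K$, from $\Gamma\vdash t_j:A_{f(j)}$ for all $j\in g^{ -1}(k)$ infer $\Gamma\vdash\iota_\dagger^k\langle t_j\rangle:\dagger\langle A_i\rangle$; from $\Gamma\vdash t:\dagger\langle A_i\rangle$ and $\Gamma,\langle y_j:A_{f(j)}\rangle_{j\in g^{ -1}(k)}\vdash s_k:C$ for all $k\in\mathcal K$ infer $\Gamma\vdash\delta_\dagger(t,\langle\langle y_j\rangle.s_k\rangle_k):C$. System $\mathtt{NI}^2$ over $\mathcal L^2$ is System F (terms $x,\lambda x.t,tu,\Lambda X.t,tB$): from $\Gamma\vdash t:A$, $X\notin FV(\Gamma)$ infer $\Gamma\vdash\Lambda X.t:\forall X.A$; from $\Gamma\vdash t:\forall X.A$ infer $\Gamma\vdash tB:A\llbracket B/X\rrbracket$. $\mathtt{NI}^2_{RP}$ is its restriction to $\mathcal L^2_{RP}$-formulas. $\mathtt{NI}^2_{at}$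 is $\mathtt{NI}^2$ with type application restricted to $tY$ with $Y$ a variable. Terms represent derivations; type information is regarded as part of the term, though not displayed, and the translations are defined by recursion on typing derivations. Reduction. $\Gamma\vdash_{\mathtt{NI}^2_{at}}t\rightsquigarrow_\beta s:A$: derivable by reflexivity, transitivity, congruence and the left-to-right rules $(\lambda x.t)s\rightsquigarrow t\llbracket s/x\rrbracket$, $(\Lambda X.t)Y\rightsquigarrow t\llbracket Y/X\rrbracket$ (multi-step reduction). Contexts. A term context has a hole $[\ ]$; $\mathtt U[t]$ is capture-avoiding, $\mathtt U\{t\}$ variable-capturing, substitution for the hole. $\mathsf{at}(B)$ is the rightmost variable of $B\in\mathcal L^2$. $\mathtt{El}_B,\mathtt{In}_B$ are defined with the same fresh variables in both: $\mathtt{El}_Z=\mathtt{In}_Z=[\ ]$ for $Z$ a variable; $\mathtt{El}_{C\supset D}=\mathtt{El}_D[[\ ]x]$, $\mathtt{In}_{C\supset D}=\lambda x.\mathtt{In}_D$; $\mathtt{El}_{\forall X.D}=\mathtt{El}_D[[\ ]X]$, $\mathtt{In}_{\forall X.D}=\Lambda X.\mathtt{In}_D$. (If the rightmost variable is bound in $B$, $\mathsf{at}(B)$ denotes the corresponding type variable used in $\mathtt{El}_B,\mathtt{In}_B$.) RP-translation. $X^*=X$, $(A\supset B)^*=A^*\supset B^*$, $(\dagger\langle A_i\rangle)^*=\forall X.\langle\langle A_{f(j)}^*\rangle_{j\in g^{ -1}(k)}\supset X\rangle_{k\in\mathcal K}\supset X$ ($X$ not free in any $A_i$); $\Gamma^*$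 is obtained by translating all types in $\Gamma$. On terms with $\Gamma\vdash_{\mathtt{NI}^p}u:A$: $x^*=x$, $(\lambda x.t)^*=\lambda x.t^*$, $(ts)^*=t^*s^*$, $(\iota_\dagger^{k_0}\langle t_j\rangle)^*=\Lambda X.\lambda\langle x_k\rangle_{k\in\mathcal K}.x_{k_0}\langle t_j^*\rangle$, and for $\delta_\dagger(t,\langle\langle y_j\rangle.s_k\rangle):A$, $(\delta_\dagger(t,\langle\langle y_j\rangle.s_k\rangle))^*=t^*A^*\langle\lambda\langle y_j\rangle.s_k^*\rangle_{k\in\mathcal K}$. The result is an $\mathtt{NI}^2_{RP}$-term of type $A^*$ in context $\Gamma^*$. FF-atomization $(\cdot)^\downarrow$ and $\varepsilon$-atomization $(\cdot)^{\downarrow^\varepsilon}$ are defined on $\mathtt{NI}^2_{RP}$-terms. For $\natural\in\{\downarrow,\downarrow^\varepsilon\}$: $x^\natural=x$, $(\lambda x.t)^\natural=\lambda x.t^\natural$, $(ts)^\natural=t^\natural s^\natural$, $(\Lambda X.t)^\natural=\Lambda X.t^\natural$, $(tY)^\natural=t^\natural Y$ for $Y$ a variable. For $t:\forall X.\langle\langle A_{f(j)}\rangle_{j\in g^{ -1}(k)}\supset X\rangle_{k\in\mathcal K}\supset X$: $(t(C\supset D))^\downarrow=\lambda\langle y_k\rangle_{k\in\mathcal K}.\lambda x.(tD)^\downarrow\langle\lambda\langle z_j\rangle_{j\in g^{ -1}(k)}.y_k\langle z_j\rangle x\rangle_{k\in\mathcal K}$; $(t(\forall X.D))^\downarrow=\lambda\langle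 y_k\rangle_{k\in\mathcal K}.\Lambda X.(tD)^\downarrow\langle\lambda\langle z_j\rangle_{j\in g^{ -1}(k)}.y_k\langle z_j\rangle X\rangle_{k\in\mathcal K}$; and, for $B$ not atomic and $Z=\mathsf{at}(B)$, $(tB)^{\downarrow^\varepsilon}=\lambda\langle y_k\rangle_{k\in\mathcal K}.\mathtt{In}_B\{t^{\downarrow^\varepsilon}Z\langle\lambda\langle w_j\rangle_{j\in g^{ -1}(k)}.\mathtt{El}_B[y_k\langle w_j\rangle]\rangle_{k\in\mathcal K}\}$. ESF-translation $(\cdot)^\sharp$ on $\mathtt{NI}^p$-terms: $x^\sharp=x$, $(\lambda x.t)^\sharp=\lambda x.t^\sharp$, $(ts)^\sharp=t^\sharp s^\sharp$, $(\iota_\dagger^{k_0}\langle t_j\rangle)^\sharp=\Lambda X.\lambda\langle x_k\rangle_{k\in\mathcal K}.x_{k_0}\langle t_j^\sharp\rangle$, and for $\delta_\dagger(t,\langle\langle y_j\rangle.s_k\rangle):A$ with $Z=\mathsf{at}(A^*)$, $(\delta_\dagger(t,\langle\langle y_j\rangle.s_k\rangle))^\sharp=\mathtt{In}_{A^*}\{t^\sharp Z\langle\lambda\langle y_j\rangle.\mathtt{El}_{A^*}[s_k^\sharp]\rangle_{k\in\mathcal K}\}$. -}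

module Defs where

open import Data.Fin using (Fin; toℕ; opposite; _≟_)
open import Data.List using (List; []; _∷_; map; foldl; foldr; tabulate; allFin; filter; length; lookup; downFrom; _ʳ++_)
open import Data.List.Relation.Unary.All using (All)
open import Data.Nat using (ℕ; zero; suc; _+_)
open import Data.Vec.Functional using (Vector)
open import Function using (_∘_)

infixr 7 _⊃_ _⊃*_
infixl 8 _·_ _∙_ _∙[_,_]_
infix  9 _[_] _⟦_⟧ _⟦_⟧ᵗ
infix 10 _* _*ᵗ _↓ _↓ᵋ _♯
infix  4 _∋_∶_ _⊢ᵖ_∶_ _⊢RP_∶_ _⊢at_∶_ _⊢at_⇝_∶_

-- Term and type variables are de Bruijn indices.  Indices beyond the
-- enclosing quantifiers are free type variables, so there are infinitely
-- many of these; the scoping of term variables is enforced by typing.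

-- The lists 𝓘, 𝓙, 𝓚 only serve as index sets, hence Fin.
record Connective : Set where
  field
    I J K : ℕ
    f     : Fin J → Fin I
    g     : Fin J → Fin K

  fibre : Fin K → List (Fin J)
  fibre k = filter (λ j → g j ≟ k) (allFin J)

  arity : Fin K → ℕ
  arity k = length (fibre k)

open Connective public

ext : (ℕ → ℕ) → ℕ → ℕ
ext ρ zero    = zero
ext ρ (suc x) = suc (ρ x)

ext^ : ℕ → (ℕ → ℕ) → ℕ → ℕ
ext^ zero    ρ = ρ
ext^ (suc n) ρ = ext (ext^ n ρ)

data _∋_∶_ {F : Set} : List F → ℕ → F → Set where
  here  : ∀ {Γ A} → A ∷ Γ ∋ zero ∶ A
  there : ∀ {Γ A B x} → Γ ∋ x ∶ A → B ∷ Γ ∋ suc x ∶ A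

data Tyᵖ : Set where
  tvar : ℕ → Tyᵖ
  _⊃_  : Tyᵖ → Tyᵖ → Tyᵖ
  †    : (c : Connective) → Vector Tyᵖ (I c) → Tyᵖ

-- Type information is part of a term (here and below): abstractions carry
-- the type of their variable, ι and δ carry the connective and the Aᵢ, and
-- δ also carries (last) the type of the conclusion.
-- In  δ c As t ss C  the term ss k lies under the arity k binders ⟨yⱼ⟩, the
-- first of them being the outermost.
data Tmᵖ : Set where
  var : ℕ → Tmᵖ
  ƛ   : Tyᵖ → Tmᵖ → Tmᵖ
  _·_ : Tmᵖ → Tmᵖ → Tmᵖ
  ι   : (c : Connective) → Vector Tyᵖ (I c) →
        (k : Fin (K c)) → Vector Tmᵖ (arity c k) → Tmᵖ
  δ   : (c : Connective) → Vector Tyᵖ (I c) →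
        Tmᵖ → Vector Tmᵖ (K c) → Tyᵖ → Tmᵖ

-- ⟨A_{f(j)}⟩ for j ∈ g⁻¹(k)
hyps : {F : Set} (c : Connective) → Vector F (I c) → Fin (K c) → List F
hyps c As k = map (λ j → As (f c j)) (fibre c k)

data _⊢ᵖ_∶_ (Γ : List Tyᵖ) : Tmᵖ → Tyᵖ → Set where
  var : ∀ {x A} → Γ ∋ x ∶ A → Γ ⊢ᵖ var x ∶ A
  ƛ   : ∀ {A B t} → A ∷ Γ ⊢ᵖ t ∶ B → Γ ⊢ᵖ ƛ A t ∶ A ⊃ B
  _·_ : ∀ {A B t u} → Γ ⊢ᵖ t ∶ A ⊃ B → Γ ⊢ᵖ u ∶ A → Γ ⊢ᵖ t · u ∶ B
  ι   : ∀ {c As k ts} →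
        (∀ p → Γ ⊢ᵖ ts p ∶ As (f c (lookup (fibre c k) p))) →
        Γ ⊢ᵖ ι c As k ts ∶ † c As
  δ   : ∀ {c As t ss C} →
        Γ ⊢ᵖ t ∶ † c As →
        (∀ k → hyps c As k ʳ++ Γ ⊢ᵖ ss k ∶ C) →
        Γ ⊢ᵖ δ c As t ss C ∶ C

data Ty : Set where
  tvar : ℕ → Ty
  _⊃_  : Ty → Ty → Ty
  `∀   : Ty → Ty

renTy : (ℕ → ℕ) → Ty → Ty
renTy ρ (tvar X) = tvar (ρ X)
renTy ρ (A ⊃ B)  = renTy ρ A ⊃ renTy ρ B
renTy ρ (`∀ A)   = `∀ (renTy (ext ρ) A)

extTy : (ℕ → Ty) → ℕ → Ty
extTy σ zero    = tvar zero
extTy σ (suc X) = renTy suc (σ X)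

subTy : (ℕ → Ty) → Ty → Ty
subTy σ (tvar X) = σ X
subTy σ (A ⊃ B)  = subTy σ A ⊃ subTy σ B
subTy σ (`∀ A)   = `∀ (subTy (extTy σ) A)

singleTy : Ty → ℕ → Ty
singleTy B zero    = B
singleTy B (suc X) = tvar X

_⟦_⟧ : Ty → Ty → Ty
A ⟦ B ⟧ = subTy (singleTy B) A

-- ⟨A_a⟩ ⊃ B
_⊃*_ : List Ty → Ty → Ty
As ⊃* B = foldr _⊃_ B As

-- ⟨ ⟨A_{f(j)}⟩_{j ∈ g⁻¹(k)} ⊃ B ⟩ₖ
alts : (c : Connective) → Vector Ty (I c) → Ty → List Ty
alts c As B = tabulate (λ k → hyps c As k ⊃* B)

RPbody : (c : Connective) → Vector Ty (I c) → Ty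
RPbody c As = alts c (renTy suc ∘ As) (tvar 0) ⊃* tvar 0

data RP : Ty → Set where
  tvar : ∀ X → RP (tvar X)
  _⊃_  : ∀ {A B} → RP A → RP B → RP (A ⊃ B)
  `∀   : ∀ c {As : Vector Ty (I c)} → (∀ i → RP (As i)) → RP (`∀ (RPbody c As))

-- NI²_RP-terms are the elements of TmRP typable by _⊢RP_∶_; since the terms
-- carry the type information, the atomizations below are defined by recursion
-- on the terms and never look at the typing.
-- In  t ∙[ c , As ] B  the pair c , As records the type
-- `∀ (RPbody c As)  of t.
data TmRP : Set where
  var      : ℕ → TmRP
  ƛ        : Ty → TmRP → TmRP
  _·_      : TmRP → TmRP → TmRP
  Λ        : TmRP → TmRP
  _∙[_,_]_ : TmRP → (c : Connective) → Vector Ty (I c) → Ty → TmRP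

-- The formulas in contexts are required to be RP at the leaves, which makes
-- all formulas of a derivation RP.
data _⊢RP_∶_ (Γ : List Ty) : TmRP → Ty → Set where
  var  : ∀ {x A} → All RP Γ → Γ ∋ x ∶ A → Γ ⊢RP var x ∶ A
  ƛ    : ∀ {A B t} → A ∷ Γ ⊢RP t ∶ B → Γ ⊢RP ƛ A t ∶ A ⊃ B
  _·_  : ∀ {A B t u} → Γ ⊢RP t ∶ A ⊃ B → Γ ⊢RP u ∶ A → Γ ⊢RP t · u ∶ B
  Λ    : ∀ {A t} → RP (`∀ A) → map (renTy suc) Γ ⊢RP t ∶ A → Γ ⊢RP Λ t ∶ `∀ A
  inst : ∀ {c As t B} → RP B → Γ ⊢RP t ∶ `∀ (RPbody c As) →
         Γ ⊢RP t ∙[ c , As ] B ∶ RPbody c As ⟦ B ⟧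

-- Renaming by ρ on type variables and by ξ on term variables.
renRP : (ρ ξ : ℕ → ℕ) → TmRP → TmRP
renRP ρ ξ (var x)            = var (ξ x)
renRP ρ ξ (ƛ A t)            = ƛ (renTy ρ A) (renRP ρ (ext ξ) t)
renRP ρ ξ (t · u)            = renRP ρ ξ t · renRP ρ ξ u
renRP ρ ξ (Λ t)              = Λ (renRP (ext ρ) ξ t)
renRP ρ ξ (t ∙[ c , As ] B)  = renRP ρ ξ t ∙[ c , renTy ρ ∘ As ] renTy ρ B

-- Terms of all of NI²; the restriction to NI²_at is in the typing of _∙_.
data Tm : Set where
  var : ℕ → Tm
  ƛ   : Ty → Tm → Tm
  _·_ : Tm → Tm → Tm
  Λ   : Tm → Tm
  _∙_ : Tm → Ty → Tm

data _⊢at_∶_ (Γ : List Ty) : Tm → Ty → Set where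
  var : ∀ {x A} → Γ ∋ x ∶ A → Γ ⊢at var x ∶ A
  ƛ   : ∀ {A B t} → A ∷ Γ ⊢at t ∶ B → Γ ⊢at ƛ A t ∶ A ⊃ B
  _·_ : ∀ {A B t u} → Γ ⊢at t ∶ A ⊃ B → Γ ⊢at u ∶ A → Γ ⊢at t · u ∶ B
  Λ   : ∀ {A t} → map (renTy suc) Γ ⊢at t ∶ A → Γ ⊢at Λ t ∶ `∀ A
  _∙_ : ∀ {A t} → Γ ⊢at t ∶ `∀ A → ∀ Y → Γ ⊢at t ∙ tvar Y ∶ A ⟦ tvar Y ⟧

ren : (ρ ξ : ℕ → ℕ) → Tm → Tm
ren ρ ξ (var x) = var (ξ x)
ren ρ ξ (ƛ A t) = ƛ (renTy ρ A) (ren ρ (ext ξ) t)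
ren ρ ξ (t · u) = ren ρ ξ t · ren ρ ξ u
ren ρ ξ (Λ t)   = Λ (ren (ext ρ) ξ t)
ren ρ ξ (t ∙ B) = ren ρ ξ t ∙ renTy ρ B

-- Weakening by m type variables and n term variables.
wk : (m n : ℕ) → Tm → Tm
wk m n = ren (m +_) (n +_)

subTmTy : (ℕ → Ty) → Tm → Tm
subTmTy σ (var x) = var x
subTmTy σ (ƛ A t) = ƛ (subTy σ A) (subTmTy σ t)
subTmTy σ (t · u) = subTmTy σ t · subTmTy σ u
subTmTy σ (Λ t)   = Λ (subTmTy (extTy σ) t)
subTmTy σ (t ∙ B) = subTmTy σ t ∙ subTy σ B

_⟦_⟧ᵗ : Tm → Ty → Tm
t ⟦ B ⟧ᵗ = subTmTy (singleTy B) t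

extTm : (ℕ → Tm) → ℕ → Tm
extTm σ zero    = var zero
extTm σ (suc x) = wk 0 1 (σ x)

subTm : (ℕ → Tm) → Tm → Tm
subTm σ (var x) = σ x
subTm σ (ƛ A t) = ƛ A (subTm (extTm σ) t)
subTm σ (t · u) = subTm σ t · subTm σ u
subTm σ (Λ t)   = Λ (subTm (wk 1 0 ∘ σ) t)
subTm σ (t ∙ B) = subTm σ t ∙ B

singleTm : Tm → ℕ → Tm
singleTm s zero    = s
singleTm s (suc x) = var x

_[_] : Tm → Tm → Tm
t [ s ] = subTm (singleTm s) t

data _⊢at_⇝_∶_ (Γ : List Ty) : Tm → Tm → Ty → Set where
  ⇝-refl  : ∀ {t A} → Γ ⊢at t ∶ A → Γ ⊢at t ⇝ t ∶ A
  ⇝-trans : ∀ {t u v A} → Γ ⊢at t ⇝ u ∶ A → Γ ⊢at u ⇝ v ∶ A → Γ ⊢at t ⇝ v ∶ A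
  ⇝-ƛ     : ∀ {A B t t′} → A ∷ Γ ⊢at t ⇝ t′ ∶ B → Γ ⊢at ƛ A t ⇝ ƛ A t′ ∶ A ⊃ B
  ⇝-·     : ∀ {A B t t′ u u′} → Γ ⊢at t ⇝ t′ ∶ A ⊃ B → Γ ⊢at u ⇝ u′ ∶ A →
            Γ ⊢at t · u ⇝ t′ · u′ ∶ B
  ⇝-Λ     : ∀ {A t t′} → map (renTy suc) Γ ⊢at t ⇝ t′ ∶ A → Γ ⊢at Λ t ⇝ Λ t′ ∶ `∀ A
  ⇝-∙     : ∀ {A t t′} → Γ ⊢at t ⇝ t′ ∶ `∀ A → ∀ Y →
            Γ ⊢at t ∙ tvar Y ⇝ t′ ∙ tvar Y ∶ A ⟦ tvar Y ⟧
  β-⊃     : ∀ {A B t s} → A ∷ Γ ⊢at t ∶ B → Γ ⊢at s ∶ A →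
            Γ ⊢at ƛ A t · s ⇝ t [ s ] ∶ B
  β-∀     : ∀ {A t} → map (renTy suc) Γ ⊢at t ∶ A → ∀ Y →
            Γ ⊢at Λ t ∙ tvar Y ⇝ t ⟦ tvar Y ⟧ᵗ ∶ A ⟦ tvar Y ⟧

lamsRP : List Ty → TmRP → TmRP
lamsRP As t = foldr ƛ t As

appsRP : TmRP → List TmRP → TmRP
appsRP = foldl _·_

lams : List Ty → Tm → Tm
lams As t = foldr ƛ t As

apps : Tm → List Tm → Tm
apps = foldl _·_

-- The de Bruijn index of the k-th of n variables bound by consecutive
-- abstractions, seen from below the last one.
pos : ∀ {n} → Fin n → ℕ
pos k = toℕ (opposite k)

-- All of these n variables, in order of binding.
vars : ℕ → List Tm
vars n = map var (downFrom n)

_* : Tyᵖ → Ty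
tvar X *  = tvar X
(A ⊃ B) * = A * ⊃ B *
† c As *  = `∀ (RPbody c (λ i → As i *))

_*ᵗ : Tmᵖ → TmRP
var x *ᵗ       = var x
ƛ A t *ᵗ       = ƛ (A *) (t *ᵗ)
(t · u) *ᵗ     = t *ᵗ · u *ᵗ
ι c As k ts *ᵗ =
  Λ (lamsRP (alts c (λ i → renTy suc (As i *)) (tvar 0))
    (appsRP (var (pos k))
      (tabulate (λ p → renRP suc (K c +_) (ts p *ᵗ)))))
δ c As t ss C *ᵗ =
  appsRP (t *ᵗ ∙[ c , (λ i → As i *) ] C *)
    (tabulate (λ k → lamsRP (hyps c (λ i → As i *) k) (ss k *ᵗ)))

-- Number of abstractions, resp. type abstractions, in In_B.
#⊃ #∀ : Ty → ℕ
#⊃ (tvar Z) = 0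
#⊃ (C ⊃ D)  = suc (#⊃ D)
#⊃ (`∀ D)   = #⊃ D
#∀ (tvar Z) = 0
#∀ (C ⊃ D)  = #∀ D
#∀ (`∀ D)   = suc (#∀ D)

-- The rightmost variable of B, as an index in the scope of the hole of In_B.
at : Ty → ℕ
at (tvar Z) = Z
at (C ⊃ D)  = at D
at (`∀ D)   = at D

-- In_B{t}: t lives in the scope of the binders of In_B.
In : Ty → Tm → Tm
In (tvar Z) t = t
In (C ⊃ D)  t = ƛ C (In D t)
In (`∀ D)   t = Λ (In D t)

-- El_B[t], placed in the hole of In_B below n further term binders: the
-- variables of El_B are those bound by In_B, and t lives in the same scope as
-- the result.
El : (n : ℕ) → Ty → Tm → Tm
El n (tvar Z) t = t
El n (C ⊃ D)  t = El n D (t · var (n + #⊃ D))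
El n (`∀ D)   t = El n D (t ∙ tvar (#∀ D))

-- The two atomizations differ in the clause for type application only:
-- app c As t B  is the atomization of a type application to B of a term of
-- type  `∀ (RPbody c As)  whose own atomization is t.
module Atomize
  (app : (c : Connective) → Vector Ty (I c) → Tm → Ty → Tm)
  where

  atomize : TmRP → Tm
  atomize (var x)           = var x
  atomize (ƛ A t)           = ƛ A (atomize t)
  atomize (t · u)           = atomize t · atomize u
  atomize (Λ t)             = Λ (atomize t)
  atomize (t ∙[ c , As ] B) = app c As (atomize t) B

-- (t D)^↓ occurs in (t (C ⊃ D))^↓ and (t (∀X.D))^↓ below additional binders,
-- hence with t weakened.
appFF : (c : Connective) → Vector Ty (I c) → Tm → Ty → Tm
appFF c As t (tvar Y) = t ∙ tvar Y
appFF c As t (C ⊃ D)  =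
  lams (alts c As (C ⊃ D)) (ƛ C
    (apps (appFF c As (wk 0 (suc (K c)) t) D)
      (tabulate (λ k → lams (hyps c As k)
        (apps (var (arity c k + suc (pos k))) (vars (arity c k))
          · var (arity c k))))))
appFF c As t (`∀ D)   =
  lams (alts c As (`∀ D)) (Λ
    (apps (appFF c (renTy suc ∘ As) (wk 1 (K c) t) D)
      (tabulate (λ k → lams (hyps c (renTy suc ∘ As) k)
        (apps (var (arity c k + pos k)) (vars (arity c k)) ∙ tvar 0)))))

appε : (c : Connective) → Vector Ty (I c) → Tm → Ty → Tm
appε c As t (tvar Y) = t ∙ tvar Y
appε c As t B        =
  lams (alts c As B) (In B
    (apps (wk (#∀ B) (#⊃ B + K c) t ∙ tvar (at B))
      (tabulate (λ k → lams (hyps c (renTy (#∀ B +_) ∘ As) k)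
        (El (arity c k) B
          (apps (var (arity c k + (#⊃ B + pos k))) (vars (arity c k))))))))

_↓ _↓ᵋ : TmRP → Tm
_↓  = Atomize.atomize appFF
_↓ᵋ = Atomize.atomize appε

_♯ : Tmᵖ → Tm
var x ♯       = var x
ƛ A t ♯       = ƛ (A *) (t ♯)
(t · u) ♯     = t ♯ · u ♯
ι c As k ts ♯ =
  Λ (lams (alts c (λ i → renTy suc (As i *)) (tvar 0))
    (apps (var (pos k)) (tabulate (λ p → wk 1 (K c) (ts p ♯)))))
δ c As t ss C ♯ =
  In B
    (apps (wk (#∀ B) (#⊃ B) (t ♯) ∙ tvar (at B))
      (tabulate (λ k → lams (hyps c (λ i → renTy (#∀ B +_) (As i *)) k)
        (El (arity c k) B
          (ren (#∀ B +_) (ext^ (arity c k) (#⊃ B +_)) (ss k ♯))))))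
  where
  B = C *

{-# OPTIONS --safe #-}
module Submission where

-- Both reductions hold on raw terms, by contractions of term abstractions alone,
-- and subject-reduction turns them into typed ones, starting from the typing of
-- u*↓ (⊢-*↓).  The typings of u*↓ᵋ and of u♯ come out of subject reduction as
-- well, so that In and El need not be typed.
--
-- The two sides are compared through one auxiliary function: esf c As B t us is
-- the ESF-translation of a δ whose conclusion has the translation B, whose major
-- premise becomes t and whose branches become us.  It is defined by recursion on
-- B and introduces one binder of In_B at a time; esf-In-El identifies it with
-- the term built from In_B and El_B.  For B not atomic the ε-atomization of a
-- type application tB is then  λ⟨yₖ⟩. esf B t ⟨yₖ⟨w⟩⟩,  and the fact that carries
-- both parts is cases-appε:
--
--   (tB)^↓ᵋ ⟨λ⟨yⱼ⟩.uₖ⟩ₖ  reduces to  esf c As B t us ,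
--
-- where t on the right stands for its own atomization.  It holds since contracting
-- the outer abstractions puts the branch λ⟨yⱼ⟩.uₖ in the place of yₖ, and
-- contracting (λ⟨yⱼ⟩.uₖ)⟨w⟩, whose arguments are variables, gives uₖ back.
--
-- Part (2) is an induction on u, with cases-appε applied to the translation of
-- each δ.  Part (1) rests on appFF⟶appε, by induction on B: in (t(C ⊃ D))^↓
-- the subterm (tD)^↓ reduces to (tD)^↓ᵋ by induction hypothesis and stands
-- applied to a list of branches, so cases-appε turns it into the corresponding
-- esf c As D, and the recursion equation of esf yields (t(C ⊃ D))^↓ᵋ; the case
-- of a quantifier is the same.

open import Defs
open import Data.Fin using (Fin; zero; suc; toℕ; opposite)
open import Data.Fin.Properties using (toℕ-fromℕ; toℕ-inject₁; toℕ<n)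
open import Data.List using (List; []; _∷_; map; tabulate; length; lookup; downFrom; _ʳ++_)
open import Data.List.Properties
  using (map-cong; map-∘; map-tabulate; tabulate-cong; length-tabulate; length-downFrom; length-map; map-ʳ++)
open import Data.List.Relation.Binary.Pointwise as Pointwise using (Pointwise; []; _∷_)
open import Data.Nat using (ℕ; zero; suc; _+_; _<_; s≤s)
open import Data.Nat.Properties using (+-identityʳ; +-suc; +-assoc; suc-injective; n<1+n; m<n⇒m<1+n)
open import Data.Product using (_×_; _,_; ∃; proj₁)
open import Data.Vec.Functional using (Vector)
open import Function using (_∘_; id)
open import Relation.Binary.PropositionalEquality
  using (_≡_; _≗_; refl; sym; trans; cong; cong₂; subst; module ≡-Reasoning)

private variable
  Γ Δ   : List Ty
  A B C : Ty
  t t′ s u v : Tm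
  ρ ρ′ ξ ξ′ : ℕ → ℕ
  σ σ′ : ℕ → Tm

-- Renaming of types

ext-cong : ρ ≗ ρ′ → ext ρ ≗ ext ρ′
ext-cong e zero    = refl
ext-cong e (suc x) = cong suc (e x)

ext-∘ : ∀ ρ ρ′ → ext ρ ∘ ext ρ′ ≗ ext (ρ ∘ ρ′)
ext-∘ ρ ρ′ zero    = refl
ext-∘ ρ ρ′ (suc x) = refl

ext-id : ext id ≗ id
ext-id zero    = refl
ext-id (suc x) = refl

renTy-cong : ρ ≗ ρ′ → renTy ρ ≗ renTy ρ′
renTy-cong e (tvar X) = cong tvar (e X)
renTy-cong e (A ⊃ B)  = cong₂ _⊃_ (renTy-cong e A) (renTy-cong e B)
renTy-cong e (`∀ A)   = cong `∀ (renTy-cong (ext-cong e) A)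

renTy-∘ : ∀ ρ ρ′ → renTy ρ ∘ renTy ρ′ ≗ renTy (ρ ∘ ρ′)
renTy-∘ ρ ρ′ (tvar X) = refl
renTy-∘ ρ ρ′ (A ⊃ B)  = cong₂ _⊃_ (renTy-∘ ρ ρ′ A) (renTy-∘ ρ ρ′ B)
renTy-∘ ρ ρ′ (`∀ A)   =
  cong `∀ (trans (renTy-∘ (ext ρ) (ext ρ′) A) (renTy-cong (ext-∘ ρ ρ′) A))

renTy-id : renTy id ≗ id
renTy-id (tvar X) = refl
renTy-id (A ⊃ B)  = cong₂ _⊃_ (renTy-id A) (renTy-id B)
renTy-id (`∀ A)   = cong `∀ (trans (renTy-cong ext-id A) (renTy-id A))

renTy-comm : ∀ {ρ₁ ρ₂ ρ₃ ρ₄ : ℕ → ℕ} → ρ₁ ∘ ρ₂ ≗ ρ₃ ∘ ρ₄ →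
  renTy ρ₁ ∘ renTy ρ₂ ≗ renTy ρ₃ ∘ renTy ρ₄
renTy-comm {ρ₁} {ρ₂} {ρ₃} {ρ₄} e A =
  trans (renTy-∘ ρ₁ ρ₂ A) (trans (renTy-cong e A) (sym (renTy-∘ ρ₃ ρ₄ A)))

renTy-ext-suc : ∀ ρ → renTy (ext ρ) ∘ renTy suc ≗ renTy suc ∘ renTy ρ
renTy-ext-suc ρ = renTy-comm (λ _ → refl)

-- The renaming that substitutes the variable Y for the variable 0.
instVar : ℕ → ℕ → ℕ
instVar Y zero    = Y
instVar Y (suc X) = X

subTy-tvar : ∀ {τ : ℕ → Ty} → τ ≗ tvar ∘ ρ → subTy τ ≗ renTy ρ
subTy-tvar e (tvar X) = e X
subTy-tvar e (A ⊃ B)  = cong₂ _⊃_ (subTy-tvar e A) (subTy-tvar e B)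
subTy-tvar {ρ} {τ} e (`∀ A) = cong `∀ (subTy-tvar e′ A)
  where
  e′ : extTy τ ≗ tvar ∘ ext ρ
  e′ zero    = refl
  e′ (suc X) = cong (renTy suc) (e X)

⟦tvar⟧ : ∀ A Y → A ⟦ tvar Y ⟧ ≡ renTy (instVar Y) A
⟦tvar⟧ A Y = subTy-tvar (λ { zero → refl ; (suc X) → refl }) A

renTy-⟦tvar⟧ : ∀ ρ A Y → renTy ρ (A ⟦ tvar Y ⟧) ≡ renTy (ext ρ) A ⟦ tvar (ρ Y) ⟧
renTy-⟦tvar⟧ ρ A Y = begin
  renTy ρ (A ⟦ tvar Y ⟧)                     ≡⟨ cong (renTy ρ) (⟦tvar⟧ A Y) ⟩
  renTy ρ (renTy (instVar Y) A)              ≡⟨ renTy-comm (λ { zero → refl ; (suc X) → refl }) A ⟩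
  renTy (instVar (ρ Y)) (renTy (ext ρ) A)    ≡⟨ ⟦tvar⟧ (renTy (ext ρ) A) (ρ Y) ⟨
  renTy (ext ρ) A ⟦ tvar (ρ Y) ⟧             ∎
  where open ≡-Reasoning

-- Iterated extension of renamings

ext^-cong : ∀ n → ξ ≗ ξ′ → ext^ n ξ ≗ ext^ n ξ′
ext^-cong zero    e = e
ext^-cong (suc n) e = ext-cong (ext^-cong n e)

ext^-∘ : ∀ n ξ ξ′ → ext^ n ξ ∘ ext^ n ξ′ ≗ ext^ n (ξ ∘ ξ′)
ext^-∘ zero    ξ ξ′ x = refl
ext^-∘ (suc n) ξ ξ′ x =
  trans (ext-∘ (ext^ n ξ) (ext^ n ξ′) x) (ext-cong (ext^-∘ n ξ ξ′) x)

ext^-id : ∀ n → ext^ n id ≗ id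
ext^-id zero    x = refl
ext^-id (suc n) x = trans (ext-cong (ext^-id n) x) (ext-id x)

ext^-+ : ∀ n ξ x → ext^ n ξ (n + x) ≡ n + ξ x
ext^-+ zero    ξ x = refl
ext^-+ (suc n) ξ x = cong suc (ext^-+ n ξ x)

ext^-< : ∀ {n x} ξ → x < n → ext^ n ξ x ≡ x
ext^-< {suc n} {zero}  ξ _       = refl
ext^-< {suc n} {suc x} ξ (s≤s l) = cong suc (ext^-< ξ l)

ext^-pos : ∀ {n} ξ (k : Fin n) → ext^ n ξ (pos k) ≡ pos k
ext^-pos ξ k = ext^-< ξ (toℕ<n (opposite k))

ext^-at : ∀ n ξ → ext^ n ξ n ≡ n + ξ 0
ext^-at n ξ = trans (cong (ext^ n ξ) (sym (+-identityʳ n))) (ext^-+ n ξ 0)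

-- Renaming of terms

ren-cong : ρ ≗ ρ′ → ξ ≗ ξ′ → ren ρ ξ ≗ ren ρ′ ξ′
ren-cong e f (var x) = cong var (f x)
ren-cong e f (ƛ A t) = cong₂ ƛ (renTy-cong e A) (ren-cong e (ext-cong f) t)
ren-cong e f (t · u) = cong₂ _·_ (ren-cong e f t) (ren-cong e f u)
ren-cong e f (Λ t)   = cong Λ (ren-cong (ext-cong e) f t)
ren-cong e f (t ∙ B) = cong₂ _∙_ (ren-cong e f t) (renTy-cong e B)

ren-∘ : ∀ ρ ξ ρ′ ξ′ → ren ρ ξ ∘ ren ρ′ ξ′ ≗ ren (ρ ∘ ρ′) (ξ ∘ ξ′)
ren-∘ ρ ξ ρ′ ξ′ (var x) = refl
ren-∘ ρ ξ ρ′ ξ′ (ƛ A t) = cong₂ ƛ (renTy-∘ ρ ρ′ A)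
  (trans (ren-∘ ρ (ext ξ) ρ′ (ext ξ′) t) (ren-cong (λ _ → refl) (ext-∘ ξ ξ′) t))
ren-∘ ρ ξ ρ′ ξ′ (t · u) = cong₂ _·_ (ren-∘ ρ ξ ρ′ ξ′ t) (ren-∘ ρ ξ ρ′ ξ′ u)
ren-∘ ρ ξ ρ′ ξ′ (Λ t)   = cong Λ
  (trans (ren-∘ (ext ρ) ξ (ext ρ′) ξ′ t) (ren-cong (ext-∘ ρ ρ′) (λ _ → refl) t))
ren-∘ ρ ξ ρ′ ξ′ (t ∙ B) = cong₂ _∙_ (ren-∘ ρ ξ ρ′ ξ′ t) (renTy-∘ ρ ρ′ B)

ren-comm : ∀ {ρ₁ ρ₂ ρ₃ ρ₄ ξ₁ ξ₂ ξ₃ ξ₄ : ℕ → ℕ} →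
  ρ₁ ∘ ρ₂ ≗ ρ₃ ∘ ρ₄ → ξ₁ ∘ ξ₂ ≗ ξ₃ ∘ ξ₄ →
  ren ρ₁ ξ₁ ∘ ren ρ₂ ξ₂ ≗ ren ρ₃ ξ₃ ∘ ren ρ₄ ξ₄
ren-comm {ρ₁} {ρ₂} {ρ₃} {ρ₄} {ξ₁} {ξ₂} {ξ₃} {ξ₄} e f t =
  trans (ren-∘ ρ₁ ξ₁ ρ₂ ξ₂ t) (trans (ren-cong e f t) (sym (ren-∘ ρ₃ ξ₃ ρ₄ ξ₄ t)))

-- Simultaneous renaming and substitution

-- Simultaneous renaming of type variables and substitution of term variables;
-- ren and subTm are the instances with σ = var ∘ ξ and with ρ = id.
rsub : (ρ : ℕ → ℕ) (σ : ℕ → Tm) → Tm → Tm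
rsub ρ σ (var x) = σ x
rsub ρ σ (ƛ A t) = ƛ (renTy ρ A) (rsub ρ (extTm σ) t)
rsub ρ σ (t · u) = rsub ρ σ t · rsub ρ σ u
rsub ρ σ (Λ t)   = Λ (rsub (ext ρ) (wk 1 0 ∘ σ) t)
rsub ρ σ (t ∙ B) = rsub ρ σ t ∙ renTy ρ B

extTm-cong : σ ≗ σ′ → extTm σ ≗ extTm σ′
extTm-cong e zero    = refl
extTm-cong e (suc x) = cong (wk 0 1) (e x)

rsub-cong : ρ ≗ ρ′ → σ ≗ σ′ → rsub ρ σ ≗ rsub ρ′ σ′
rsub-cong e f (var x) = f x
rsub-cong e f (ƛ A t) = cong₂ ƛ (renTy-cong e A) (rsub-cong e (extTm-cong f) t)
rsub-cong e f (t · u) = cong₂ _·_ (rsub-cong e f t) (rsub-cong e f u)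
rsub-cong e f (Λ t)   = cong Λ (rsub-cong (ext-cong e) (cong (wk 1 0) ∘ f) t)
rsub-cong e f (t ∙ B) = cong₂ _∙_ (rsub-cong e f t) (renTy-cong e B)

rsub-var : ∀ ρ ξ → rsub ρ (var ∘ ξ) ≗ ren ρ ξ
rsub-var ρ ξ (var x) = refl
rsub-var ρ ξ (ƛ A t) = cong (ƛ (renTy ρ A))
  (trans (rsub-cong (λ _ → refl) (λ { zero → refl ; (suc x) → refl }) t) (rsub-var ρ (ext ξ) t))
rsub-var ρ ξ (t · u) = cong₂ _·_ (rsub-var ρ ξ t) (rsub-var ρ ξ u)
rsub-var ρ ξ (Λ t)   = cong Λ (rsub-var (ext ρ) ξ t)
rsub-var ρ ξ (t ∙ B) = cong (_∙ renTy ρ B) (rsub-var ρ ξ t)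

-- The hypothesis is pointwise because the extension of id under a binder is the
-- identity only pointwise.
subTm-rsub : ρ ≗ id → ∀ σ → subTm σ ≗ rsub ρ σ
subTm-rsub e σ (var x) = refl
subTm-rsub e σ (ƛ A t) =
  cong₂ ƛ (sym (trans (renTy-cong e A) (renTy-id A))) (subTm-rsub e (extTm σ) t)
subTm-rsub e σ (t · u) = cong₂ _·_ (subTm-rsub e σ t) (subTm-rsub e σ u)
subTm-rsub e σ (Λ t)   =
  cong Λ (subTm-rsub (λ x → trans (ext-cong e x) (ext-id x)) (wk 1 0 ∘ σ) t)
subTm-rsub e σ (t ∙ B) =
  cong₂ _∙_ (subTm-rsub e σ t) (sym (trans (renTy-cong e B) (renTy-id B)))

rsub-id : σ ≗ var → rsub id σ ≗ id
rsub-id e (var x) = e x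
rsub-id {σ} e (ƛ A t) = cong₂ ƛ (renTy-id A) (rsub-id e′ t)
  where
  e′ : extTm σ ≗ var
  e′ zero    = refl
  e′ (suc x) = cong (wk 0 1) (e x)
rsub-id e (t · u) = cong₂ _·_ (rsub-id e t) (rsub-id e u)
rsub-id e (Λ t)   =
  cong Λ (trans (rsub-cong ext-id (λ _ → refl) t) (rsub-id (cong (wk 1 0) ∘ e) t))
rsub-id e (t ∙ B) = cong₂ _∙_ (rsub-id e t) (renTy-id B)

ren-id : ren id id ≗ id
ren-id t = trans (sym (rsub-var id id t)) (rsub-id (λ _ → refl) t)

rsub-ren : ∀ ρ σ ρ′ ξ → rsub ρ σ ∘ ren ρ′ ξ ≗ rsub (ρ ∘ ρ′) (σ ∘ ξ)
rsub-ren ρ σ ρ′ ξ (var x) = refl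
rsub-ren ρ σ ρ′ ξ (ƛ A t) = cong₂ ƛ (renTy-∘ ρ ρ′ A)
  (trans (rsub-ren ρ (extTm σ) ρ′ (ext ξ) t)
         (rsub-cong (λ _ → refl) (λ { zero → refl ; (suc x) → refl }) t))
rsub-ren ρ σ ρ′ ξ (t · u) = cong₂ _·_ (rsub-ren ρ σ ρ′ ξ t) (rsub-ren ρ σ ρ′ ξ u)
rsub-ren ρ σ ρ′ ξ (Λ t)   = cong Λ
  (trans (rsub-ren (ext ρ) (wk 1 0 ∘ σ) (ext ρ′) ξ t)
         (rsub-cong (ext-∘ ρ ρ′) (λ _ → refl) t))
rsub-ren ρ σ ρ′ ξ (t ∙ B) = cong₂ _∙_ (rsub-ren ρ σ ρ′ ξ t) (renTy-∘ ρ ρ′ B)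

ren-rsub : ∀ ρ ξ ρ′ σ → ren ρ ξ ∘ rsub ρ′ σ ≗ rsub (ρ ∘ ρ′) (ren ρ ξ ∘ σ)
ren-rsub ρ ξ ρ′ σ (var x) = refl
ren-rsub ρ ξ ρ′ σ (ƛ A t) = cong₂ ƛ (renTy-∘ ρ ρ′ A)
  (trans (ren-rsub ρ (ext ξ) ρ′ (extTm σ) t) (rsub-cong (λ _ → refl) e t))
  where
  e : ren ρ (ext ξ) ∘ extTm σ ≗ extTm (ren ρ ξ ∘ σ)
  e zero    = refl
  e (suc x) = ren-comm (λ _ → refl) (λ _ → refl) (σ x)
ren-rsub ρ ξ ρ′ σ (t · u) = cong₂ _·_ (ren-rsub ρ ξ ρ′ σ t) (ren-rsub ρ ξ ρ′ σ u)
ren-rsub ρ ξ ρ′ σ (Λ t)   = cong Λ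
  (trans (ren-rsub (ext ρ) ξ (ext ρ′) (wk 1 0 ∘ σ) t)
         (rsub-cong (ext-∘ ρ ρ′) (λ x → ren-comm (λ _ → refl) (λ _ → refl) (σ x)) t))
ren-rsub ρ ξ ρ′ σ (t ∙ B) = cong₂ _∙_ (ren-rsub ρ ξ ρ′ σ t) (renTy-∘ ρ ρ′ B)

rsub-wk₁ : ∀ ρ σ t → rsub ρ (extTm σ) (wk 0 1 t) ≡ wk 0 1 (rsub ρ σ t)
rsub-wk₁ ρ σ t = trans (rsub-ren ρ (extTm σ) id suc t) (sym (ren-rsub id suc ρ σ t))

rsub-wkᵗ : ∀ ρ σ t → rsub (ext ρ) (wk 1 0 ∘ σ) (wk 1 0 t) ≡ wk 1 0 (rsub ρ σ t)
rsub-wkᵗ ρ σ t =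
  trans (rsub-ren (ext ρ) (wk 1 0 ∘ σ) suc id t) (sym (ren-rsub suc id ρ σ t))

rsub-rsub : ∀ ρ σ ρ′ σ′ → rsub ρ σ ∘ rsub ρ′ σ′ ≗ rsub (ρ ∘ ρ′) (rsub ρ σ ∘ σ′)
rsub-rsub ρ σ ρ′ σ′ (var x) = refl
rsub-rsub ρ σ ρ′ σ′ (ƛ A t) = cong₂ ƛ (renTy-∘ ρ ρ′ A)
  (trans (rsub-rsub ρ (extTm σ) ρ′ (extTm σ′) t) (rsub-cong (λ _ → refl) e t))
  where
  e : rsub ρ (extTm σ) ∘ extTm σ′ ≗ extTm (rsub ρ σ ∘ σ′)
  e zero    = refl
  e (suc x) = rsub-wk₁ ρ σ (σ′ x)
rsub-rsub ρ σ ρ′ σ′ (t · u) = cong₂ _·_ (rsub-rsub ρ σ ρ′ σ′ t) (rsub-rsub ρ σ ρ′ σ′ u)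
rsub-rsub ρ σ ρ′ σ′ (Λ t)   = cong Λ
  (trans (rsub-rsub (ext ρ) (wk 1 0 ∘ σ) (ext ρ′) (wk 1 0 ∘ σ′) t)
         (rsub-cong (ext-∘ ρ ρ′) (λ x → rsub-wkᵗ ρ σ (σ′ x)) t))
rsub-rsub ρ σ ρ′ σ′ (t ∙ B) = cong₂ _∙_ (rsub-rsub ρ σ ρ′ σ′ t) (renTy-∘ ρ ρ′ B)

infixr 5 _•_

-- The substitution of u for the variable 0 and of σ for the others.
_•_ : Tm → (ℕ → Tm) → ℕ → Tm
(u • σ) zero    = u
(u • σ) (suc x) = σ x

-- Substituting σ below a binder and then instantiating that binder is a single
-- substitution; this is what iterated contraction rests on.
rsub-[] : ∀ ρ σ t u → rsub ρ (extTm σ) t [ u ] ≡ rsub ρ (u • σ) t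
rsub-[] ρ σ t u = begin
  rsub ρ (extTm σ) t [ u ]                     ≡⟨ subTm-rsub (λ _ → refl) (singleTm u) (rsub ρ (extTm σ) t) ⟩
  rsub id (singleTm u) (rsub ρ (extTm σ) t)    ≡⟨ rsub-rsub id (singleTm u) ρ (extTm σ) t ⟩
  rsub ρ (rsub id (singleTm u) ∘ extTm σ) t    ≡⟨ rsub-cong (λ _ → refl) e t ⟩
  rsub ρ (u • σ) t                             ∎
  where
  open ≡-Reasoning
  e : rsub id (singleTm u) ∘ extTm σ ≗ u • σ
  e zero    = refl
  e (suc x) = trans (rsub-ren id (singleTm u) id suc (σ x)) (rsub-id (λ _ → refl) (σ x))

ren-[] : ∀ ρ ξ t s → ren ρ ξ (t [ s ]) ≡ ren ρ (ext ξ) t [ ren ρ ξ s ]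
ren-[] ρ ξ t s = begin
  ren ρ ξ (t [ s ])                                ≡⟨ cong (ren ρ ξ) (subTm-rsub (λ _ → refl) (singleTm s) t) ⟩
  ren ρ ξ (rsub id (singleTm s) t)                 ≡⟨ ren-rsub ρ ξ id (singleTm s) t ⟩
  rsub ρ (ren ρ ξ ∘ singleTm s) t                  ≡⟨ rsub-cong (λ _ → refl) (λ { zero → refl ; (suc x) → refl }) t ⟩
  rsub ρ (singleTm (ren ρ ξ s) ∘ ext ξ) t          ≡⟨ rsub-ren id (singleTm (ren ρ ξ s)) ρ (ext ξ) t ⟨
  rsub id (singleTm (ren ρ ξ s)) (ren ρ (ext ξ) t) ≡⟨ subTm-rsub (λ _ → refl) (singleTm (ren ρ ξ s)) (ren ρ (ext ξ) t) ⟨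
  ren ρ (ext ξ) t [ ren ρ ξ s ]                    ∎
  where open ≡-Reasoning

-- Iterated extension of substitutions

-- The substitution σ below n abstractions.
extTm^ : ℕ → (ℕ → Tm) → ℕ → Tm
extTm^ zero    σ = σ
extTm^ (suc n) σ = extTm (extTm^ n σ)

extTm^-extTm : ∀ n σ → extTm^ n (extTm σ) ≡ extTm (extTm^ n σ)
extTm^-extTm zero    σ = refl
extTm^-extTm (suc n) σ = cong extTm (extTm^-extTm n σ)

extTm^-var : ∀ n ξ → extTm^ n (var ∘ ξ) ≗ var ∘ ext^ n ξ
extTm^-var zero    ξ x       = refl
extTm^-var (suc n) ξ zero    = refl
extTm^-var (suc n) ξ (suc x) = cong (wk 0 1) (extTm^-var n ξ x)

extTm^-+ : ∀ n σ x → extTm^ n σ (n + x) ≡ wk 0 n (σ x)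
extTm^-+ zero    σ x = sym (ren-id (σ x))
extTm^-+ (suc n) σ x =
  trans (cong (wk 0 1) (extTm^-+ n σ x)) (ren-∘ id suc id (n +_) (σ x))

extTm^-< : ∀ {n x} σ → x < n → extTm^ n σ x ≡ var x
extTm^-< {suc n} {zero}  σ _       = refl
extTm^-< {suc n} {suc x} σ (s≤s l) = cong (wk 0 1) (extTm^-< σ l)

extTm^-comm : ∀ n {ρ ξ ξ′ : ℕ → ℕ} {σ σ′ : ℕ → Tm} → σ′ ∘ ξ ≗ ren ρ ξ′ ∘ σ →
  extTm^ n σ′ ∘ ext^ n ξ ≗ ren ρ (ext^ n ξ′) ∘ extTm^ n σ
extTm^-comm zero    e x       = e x
extTm^-comm (suc n) e zero    = refl
extTm^-comm (suc n) {σ = σ} e (suc x) =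
  trans (cong (wk 0 1) (extTm^-comm n e x)) (ren-comm (λ _ → refl) (λ _ → refl) (extTm^ n σ x))

-- Lists of abstractions and of applications

rsub-apps : ∀ ρ σ t us → rsub ρ σ (apps t us) ≡ apps (rsub ρ σ t) (map (rsub ρ σ) us)
rsub-apps ρ σ t []       = refl
rsub-apps ρ σ t (u ∷ us) = rsub-apps ρ σ (t · u) us

ren-apps : ∀ ρ ξ t us → ren ρ ξ (apps t us) ≡ apps (ren ρ ξ t) (map (ren ρ ξ) us)
ren-apps ρ ξ t []       = refl
ren-apps ρ ξ t (u ∷ us) = ren-apps ρ ξ (t · u) us

rsub-lams : ∀ {n} ρ σ As t → length As ≡ n →
  rsub ρ σ (lams As t) ≡ lams (map (renTy ρ) As) (rsub ρ (extTm^ n σ) t)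
rsub-lams ρ σ []       t refl = refl
rsub-lams ρ σ (A ∷ As) t refl = cong (ƛ (renTy ρ A))
  (trans (rsub-lams ρ (extTm σ) As t refl)
         (cong (λ τ → lams (map (renTy ρ) As) (rsub ρ τ t)) (extTm^-extTm (length As) σ)))

rsub-extTm^-var : ∀ n ρ ξ → rsub ρ (extTm^ n (var ∘ ξ)) ≗ ren ρ (ext^ n ξ)
rsub-extTm^-var n ρ ξ t =
  trans (rsub-cong (λ _ → refl) (extTm^-var n ξ) t) (rsub-var ρ (ext^ n ξ) t)

ren-lams : ∀ {n} ρ ξ As t → length As ≡ n →
  ren ρ ξ (lams As t) ≡ lams (map (renTy ρ) As) (ren ρ (ext^ n ξ) t)
ren-lams {n} ρ ξ As t e = begin
  ren ρ ξ (lams As t)                                       ≡⟨ rsub-var ρ ξ (lams As t) ⟨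
  rsub ρ (var ∘ ξ) (lams As t)                              ≡⟨ rsub-lams ρ (var ∘ ξ) As t e ⟩
  lams (map (renTy ρ) As) (rsub ρ (extTm^ n (var ∘ ξ)) t)   ≡⟨ cong (lams (map (renTy ρ) As)) (rsub-extTm^-var n ρ ξ t) ⟩
  lams (map (renTy ρ) As) (ren ρ (ext^ n ξ) t)              ∎
  where open ≡-Reasoning

map-vars : ∀ {n} (h : Tm → Tm) → (∀ {x} → x < n → h (var x) ≡ var x) → map h (vars n) ≡ vars n
map-vars {zero}  h e = refl
map-vars {suc n} h e = cong₂ _∷_ (e (n<1+n n)) (map-vars h (e ∘ m<n⇒m<1+n))

rsub-vars : ∀ n ρ σ → map (rsub ρ (extTm^ n σ)) (vars n) ≡ vars n
rsub-vars n ρ σ = map-vars {n} _ (extTm^-< σ)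

ren-vars : ∀ n ρ ξ → map (ren ρ (ext^ n ξ)) (vars n) ≡ vars n
ren-vars n ρ ξ = map-vars {n} _ (cong var ∘ ext^-< ξ)

-- Hypotheses and alternatives of a connective

module _ (c : Connective) where

  length-hyps : {F : Set} (As : Vector F (I c)) (k : Fin (K c)) → length (hyps c As k) ≡ arity c k
  length-hyps As k = length-map _ (fibre c k)

  hyps-cong : ∀ {F : Set} {As Bs : Vector F (I c)} → As ≗ Bs → hyps c As ≗ hyps c Bs
  hyps-cong e k = map-cong (λ j → e (f c j)) (fibre c k)

  map-hyps : ∀ {F G : Set} (h : F → G) (As : Vector F (I c)) k → map h (hyps c As k) ≡ hyps c (h ∘ As) k
  map-hyps h As k = sym (map-∘ (fibre c k))

  length-alts : ∀ As B → length (alts c As B) ≡ K c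
  length-alts As B = length-tabulate _

  alts-cong : ∀ {As Bs} → As ≗ Bs → ∀ B → alts c As B ≡ alts c Bs B
  alts-cong e B = tabulate-cong (λ k → cong (_⊃* B) (hyps-cong e k))

renTy-⊃* : ∀ ρ As B → renTy ρ (As ⊃* B) ≡ map (renTy ρ) As ⊃* renTy ρ B
renTy-⊃* ρ []       B = refl
renTy-⊃* ρ (A ∷ As) B = cong (renTy ρ A ⊃_) (renTy-⊃* ρ As B)

renTy-hyps : ∀ ρ c As k B → renTy ρ (hyps c As k ⊃* B) ≡ hyps c (renTy ρ ∘ As) k ⊃* renTy ρ B
renTy-hyps ρ c As k B =
  trans (renTy-⊃* ρ (hyps c As k) B) (cong (_⊃* renTy ρ B) (map-hyps c (renTy ρ) As k))

renTy-alts : ∀ ρ c As B → map (renTy ρ) (alts c As B) ≡ alts c (renTy ρ ∘ As) (renTy ρ B)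
renTy-alts ρ c As B = trans (map-tabulate _ _) (tabulate-cong (λ k → renTy-hyps ρ c As k B))

renTy-RPbody : ∀ ρ c As → renTy ρ (`∀ (RPbody c As)) ≡ `∀ (RPbody c (renTy ρ ∘ As))
renTy-RPbody ρ c As = cong `∀ (begin
  renTy (ext ρ) (RPbody c As)
    ≡⟨ renTy-⊃* (ext ρ) (alts c (renTy suc ∘ As) (tvar 0)) (tvar 0) ⟩
  map (renTy (ext ρ)) (alts c (renTy suc ∘ As) (tvar 0)) ⊃* tvar 0
    ≡⟨ cong (_⊃* tvar 0) (renTy-alts (ext ρ) c (renTy suc ∘ As) (tvar 0)) ⟩
  alts c (renTy (ext ρ) ∘ renTy suc ∘ As) (tvar 0) ⊃* tvar 0
    ≡⟨ cong (_⊃* tvar 0) (alts-cong c (λ i → renTy-ext-suc ρ (As i)) (tvar 0)) ⟩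
  RPbody c (renTy ρ ∘ As) ∎)
  where open ≡-Reasoning

RPbody-⟦tvar⟧ : ∀ c As Y → RPbody c As ⟦ tvar Y ⟧ ≡ alts c As (tvar Y) ⊃* tvar Y
RPbody-⟦tvar⟧ c As Y = begin
  RPbody c As ⟦ tvar Y ⟧
    ≡⟨ ⟦tvar⟧ (RPbody c As) Y ⟩
  renTy (instVar Y) (RPbody c As)
    ≡⟨ renTy-⊃* (instVar Y) (alts c (renTy suc ∘ As) (tvar 0)) (tvar 0) ⟩
  map (renTy (instVar Y)) (alts c (renTy suc ∘ As) (tvar 0)) ⊃* tvar Y
    ≡⟨ cong (_⊃* tvar Y) (renTy-alts (instVar Y) c (renTy suc ∘ As) (tvar 0)) ⟩
  alts c (renTy (instVar Y) ∘ renTy suc ∘ As) (tvar Y) ⊃* tvar Y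
    ≡⟨ cong (_⊃* tvar Y) (alts-cong c (λ i → trans (renTy-∘ (instVar Y) suc (As i)) (renTy-id (As i))) (tvar Y)) ⟩
  alts c As (tvar Y) ⊃* tvar Y ∎
  where open ≡-Reasoning

-- Untyped reduction

infix 4 _⟶_

-- Multi-step reduction on raw terms.  Contractions of type abstractions are
-- left out, since the atomizations and the ESF-translation only differ by
-- contractions of term abstractions.
data _⟶_ : Tm → Tm → Set where
  ⟶-refl  : t ⟶ t
  ⟶-trans : t ⟶ u → u ⟶ v → t ⟶ v
  ⟶-ƛ     : t ⟶ t′ → ƛ A t ⟶ ƛ A t′
  ⟶-·     : t ⟶ t′ → u ⟶ v → t · u ⟶ t′ · v
  ⟶-Λ     : t ⟶ t′ → Λ t ⟶ Λ t′
  ⟶-∙     : t ⟶ t′ → t ∙ B ⟶ t′ ∙ B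
  ⟶-β     : ∀ A t s → ƛ A t · s ⟶ t [ s ]

⟶-reflexive : t ≡ u → t ⟶ u
⟶-reflexive refl = ⟶-refl

⟶-ren : t ⟶ u → ren ρ ξ t ⟶ ren ρ ξ u
⟶-ren ⟶-refl        = ⟶-refl
⟶-ren (⟶-trans r q) = ⟶-trans (⟶-ren r) (⟶-ren q)
⟶-ren (⟶-ƛ r)       = ⟶-ƛ (⟶-ren r)
⟶-ren (⟶-· r q)     = ⟶-· (⟶-ren r) (⟶-ren q)
⟶-ren (⟶-Λ r)       = ⟶-Λ (⟶-ren r)
⟶-ren (⟶-∙ r)       = ⟶-∙ (⟶-ren r)
⟶-ren {ρ = ρ} {ξ} (⟶-β A t s) =
  ⟶-trans (⟶-β (renTy ρ A) (ren ρ (ext ξ) t) (ren ρ ξ s)) (⟶-reflexive (sym (ren-[] ρ ξ t s)))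

⟶-lams : ∀ As → t ⟶ u → lams As t ⟶ lams As u
⟶-lams []       r = r
⟶-lams (A ∷ As) r = ⟶-ƛ (⟶-lams As r)

⟶-apps : ∀ {us vs} → t ⟶ u → Pointwise _⟶_ us vs → apps t us ⟶ apps u vs
⟶-apps r []       = r
⟶-apps r (q ∷ qs) = ⟶-apps (⟶-· r q) qs

-- The substitution σ extended by us, whose last element goes to the variable 0.
env : (ℕ → Tm) → List Tm → ℕ → Tm
env σ []       = σ
env σ (u ∷ us) = env (u • σ) us

•-cong : ∀ u → σ ≗ σ′ → u • σ ≗ u • σ′
•-cong u e zero    = refl
•-cong u e (suc x) = e x

env-cong : ∀ us → σ ≗ σ′ → env σ us ≗ env σ′ us
env-cong []       e = e
env-cong (u ∷ us) e = env-cong us (•-cong u e)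

env-+ : ∀ {n} σ us x → length us ≡ n → env σ us (n + x) ≡ σ x
env-+ σ []       x refl = refl
env-+ σ (u ∷ us) x refl =
  trans (cong (env (u • σ) us) (sym (+-suc (length us) x))) (env-+ (u • σ) us (suc x) refl)

pos-zero : ∀ n → pos (zero {n}) ≡ n
pos-zero n = toℕ-fromℕ n

pos-suc : ∀ {n} (k : Fin n) → pos (suc k) ≡ pos k
pos-suc k = toℕ-inject₁ (opposite k)

env-pos : ∀ {n} σ (us : Vector Tm n) k → env σ (tabulate us) (pos k) ≡ us k
env-pos {suc n} σ us zero = trans
  (cong (env (us zero • σ) (tabulate (us ∘ suc))) (trans (pos-zero n) (sym (+-identityʳ n))))
  (env-+ (us zero • σ) (tabulate (us ∘ suc)) 0 (length-tabulate (us ∘ suc)))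
env-pos {suc n} σ us (suc k) =
  trans (cong (env (us zero • σ) (tabulate (us ∘ suc))) (pos-suc k)) (env-pos (us zero • σ) (us ∘ suc) k)

-- Weakening by n variables followed by putting the variables n - 1, …, 0 in for
-- these is the identity.
env-vars : ∀ n → env (Tm.var ∘ (n +_)) (vars n) ≗ var
env-vars zero    x = refl
env-vars (suc n) x = trans (env-cong (vars n) e x) (env-vars n x)
  where
  e : var n • (Tm.var ∘ (suc n +_)) ≗ Tm.var ∘ (n +_)
  e zero    = cong var (sym (+-identityʳ n))
  e (suc x) = cong var (sym (+-suc n x))

-- Contraction of a whole list of abstractions against a list of arguments.
⟶-β* : ∀ ρ σ As t us → length As ≡ length us →
  apps (rsub ρ σ (lams As t)) us ⟶ rsub ρ (env σ us) t
⟶-β* ρ σ []       t []       e = ⟶-refl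
⟶-β* ρ σ (A ∷ As) t (u ∷ us) e = ⟶-trans
  (⟶-apps {us = us}
    (⟶-trans (⟶-β (renTy ρ A) (rsub ρ (extTm σ) (lams As t)) u)
             (⟶-reflexive (rsub-[] ρ σ (lams As t) u)))
    (Pointwise.refl ⟶-refl))
  (⟶-β* ρ (u • σ) As t us (suc-injective e))

length-vars : ∀ n → length (vars n) ≡ n
length-vars n = trans (length-map Tm.var (downFrom n)) (length-downFrom n)

-- An eta-expanded list of abstractions contracts back to its body.
⟶-β-vars : ∀ {n} As t → length As ≡ n → apps (wk 0 n (lams As t)) (vars n) ⟶ t
⟶-β-vars {n} As t e =
  ⟶-trans (⟶-reflexive (cong (λ s → apps s (vars n)) (sym (rsub-var id (n +_) (lams As t)))))
  (⟶-trans (⟶-β* id (Tm.var ∘ (n +_)) As t (vars n) (trans e (sym (length-vars n))))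
           (⟶-reflexive (rsub-id (env-vars n) t)))

-- Case distinctions

-- t ⟨λ⟨yⱼ⟩.uₖ⟩ₖ,  where  us k  lies below the arity k abstractions of branch k.
cases : (c : Connective) → Vector Ty (I c) → Tm → Vector Tm (K c) → Tm
cases c As t us = apps t (tabulate (λ k → lams (hyps c As k) (us k)))

cases-cong : ∀ {c As Bs t s us vs} → As ≗ Bs → t ≡ s → us ≗ vs → cases c As t us ≡ cases c Bs s vs
cases-cong {c} e refl g = cong (apps _) (tabulate-cong (λ k → cong₂ lams (hyps-cong c e k) (g k)))

rsub-cases : ∀ ρ σ c As t us → rsub ρ σ (cases c As t us) ≡
  cases c (renTy ρ ∘ As) (rsub ρ σ t) (λ k → rsub ρ (extTm^ (arity c k) σ) (us k))
rsub-cases ρ σ c As t us =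
  trans (rsub-apps ρ σ t (tabulate branch)) (cong (apps (rsub ρ σ t))
    (trans (map-tabulate branch (rsub ρ σ)) (tabulate-cong (λ k →
      trans (rsub-lams ρ σ (hyps c As k) (us k) (length-hyps c As k))
            (cong (λ Bs → lams Bs (rsub ρ (extTm^ (arity c k) σ) (us k))) (map-hyps c (renTy ρ) As k))))))
  where
  branch : Vector Tm (K c)
  branch k = lams (hyps c As k) (us k)

ren-cases : ∀ ρ ξ c As t us → ren ρ ξ (cases c As t us) ≡
  cases c (renTy ρ ∘ As) (ren ρ ξ t) (λ k → ren ρ (ext^ (arity c k) ξ) (us k))
ren-cases ρ ξ c As t us = trans (sym (rsub-var ρ ξ (cases c As t us)))
  (trans (rsub-cases ρ (var ∘ ξ) c As t us)
         (cases-cong {c} {As = renTy ρ ∘ As} (λ _ → refl) (rsub-var ρ ξ t) (λ k → rsub-extTm^-var (arity c k) ρ ξ (us k))))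

⟶-cases : ∀ {c As us vs} → t ⟶ s → (∀ k → us k ⟶ vs k) → cases c As t us ⟶ cases c As s vs
⟶-cases {c = c} {As} r q = ⟶-apps r (Pointwise.tabulate⁺ (λ k → ⟶-lams (hyps c As k) (q k)))

-- The term  In_B(t Z ⟨λ⟨yⱼ⟩.El_B[uₖ]⟩ₖ),  Z = at B,  by recursion on B: one
-- binder of In_B is introduced at a time and its variable fed to every uₖ.  Both
-- t and λ⟨yⱼ⟩.uₖ live in the scope of the result, hence the weakenings; the
-- variable of the new abstraction has index arity k below the binders of uₖ.
esf : (c : Connective) → Vector Ty (I c) → Ty → Tm → Vector Tm (K c) → Tm
esf c As (tvar Z) t us = cases c As (t ∙ tvar Z) us
esf c As (C ⊃ D)  t us = ƛ C (esf c As D (wk 0 1 t)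
  (λ k → ren id (ext^ (arity c k) suc) (us k) · var (arity c k)))
esf c As (`∀ D)   t us = Λ (esf c (renTy suc ∘ As) D (wk 1 0 t)
  (λ k → ren suc id (us k) ∙ tvar 0))

esf-cong : ∀ {c As Bs} B {t s us vs} → As ≗ Bs → t ≡ s → us ≗ vs → esf c As B t us ≡ esf c Bs B s vs
esf-cong {c} (tvar Z) e refl g = cases-cong {c} e refl g
esf-cong (C ⊃ D)  e refl g = cong (ƛ C) (esf-cong D e refl (λ k → cong (λ u → ren id _ u · _) (g k)))
esf-cong (`∀ D)   e refl g = cong Λ
  (esf-cong D (cong (renTy suc) ∘ e) refl (λ k → cong (λ u → ren suc id u ∙ _) (g k)))

rsub-esf : ∀ ρ σ c As B t us → rsub ρ σ (esf c As B t us) ≡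
  esf c (renTy ρ ∘ As) (renTy ρ B) (rsub ρ σ t) (λ k → rsub ρ (extTm^ (arity c k) σ) (us k))
rsub-esf ρ σ c As (tvar Z) t us = rsub-cases ρ σ c As (t ∙ tvar Z) us
rsub-esf ρ σ c As (C ⊃ D)  t us = cong (ƛ (renTy ρ C))
  (trans (rsub-esf ρ (extTm σ) c As D _ _)
         (esf-cong (renTy ρ D) (λ _ → refl) (rsub-wk₁ ρ σ t) (λ k → cong₂ _·_ (under k) (bound k))))
  where
  under : ∀ k → let n = arity c k in
    rsub ρ (extTm^ n (extTm σ)) (ren id (ext^ n suc) (us k)) ≡ ren id (ext^ n suc) (rsub ρ (extTm^ n σ) (us k))
  under k = let n = arity c k in
    trans (rsub-ren ρ (extTm^ n (extTm σ)) id (ext^ n suc) (us k))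
    (trans (rsub-cong (λ _ → refl) (extTm^-comm n (λ _ → refl)) (us k))
           (sym (ren-rsub id (ext^ n suc) ρ (extTm^ n σ) (us k))))
  bound : ∀ k → extTm^ (arity c k) (extTm σ) (arity c k) ≡ var (arity c k)
  bound k = trans (cong (λ τ → τ (arity c k)) (extTm^-extTm (arity c k) σ)) (extTm^-< {suc (arity c k)} σ (n<1+n _))
rsub-esf ρ σ c As (`∀ D)   t us = cong Λ
  (trans (rsub-esf (ext ρ) (wk 1 0 ∘ σ) c (renTy suc ∘ As) D _ _)
         (esf-cong (renTy (ext ρ) D) (λ i → renTy-ext-suc ρ (As i)) (rsub-wkᵗ ρ σ t)
                   (λ k → cong (_∙ tvar 0) (under k))))
  where
  under : ∀ k → let n = arity c k in
    rsub (ext ρ) (extTm^ n (wk 1 0 ∘ σ)) (ren suc id (us k)) ≡ ren suc id (rsub ρ (extTm^ n σ) (us k))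
  under k = let n = arity c k in
    trans (rsub-ren (ext ρ) (extTm^ n (wk 1 0 ∘ σ)) suc id (us k))
    (trans (rsub-cong (λ _ → refl) (λ x →
             trans (cong (extTm^ n (wk 1 0 ∘ σ)) (sym (ext^-id n x)))
             (trans (extTm^-comm n {ξ = id} {ξ′ = id} {σ = σ} (λ _ → refl) x)
                    (ren-cong (λ _ → refl) (ext^-id n) (extTm^ n σ x)))) (us k))
           (sym (ren-rsub suc id ρ (extTm^ n σ) (us k))))

ren-esf : ∀ ρ ξ c As B t us → ren ρ ξ (esf c As B t us) ≡
  esf c (renTy ρ ∘ As) (renTy ρ B) (ren ρ ξ t) (λ k → ren ρ (ext^ (arity c k) ξ) (us k))
ren-esf ρ ξ c As B t us = trans (sym (rsub-var ρ ξ (esf c As B t us)))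
  (trans (rsub-esf ρ (var ∘ ξ) c As B t us)
         (esf-cong (renTy ρ B) (λ _ → refl) (rsub-var ρ ξ t) (λ k → rsub-extTm^-var (arity c k) ρ ξ (us k))))

⟶-esf : ∀ {c As us vs} B → t ⟶ s → (∀ k → us k ⟶ vs k) → esf c As B t us ⟶ esf c As B s vs
⟶-esf {c = c} {As} (tvar Z) r q = ⟶-cases {c = c} {As} (⟶-∙ r) q
⟶-esf (C ⊃ D)  r q = ⟶-ƛ (⟶-esf D (⟶-ren r) (λ k → ⟶-· (⟶-ren (q k)) ⟶-refl))
⟶-esf (`∀ D)   r q = ⟶-Λ (⟶-esf D (⟶-ren r) (λ k → ⟶-∙ (⟶-ren (q k))))

-- The indices by which El_B refers to the binders of In_B are those that the
-- variables introduced by esf acquire below the remaining binders of In_B.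
esf-In-El : ∀ c As B t us → esf c As B t us ≡
  In B (cases c (renTy (#∀ B +_) ∘ As) (wk (#∀ B) (#⊃ B) t ∙ tvar (at B))
    (λ k → El (arity c k) B (ren (#∀ B +_) (ext^ (arity c k) (#⊃ B +_)) (us k))))
esf-In-El c As (tvar Z) t us = cases-cong {c}
  (λ i → sym (renTy-id (As i))) (cong (_∙ tvar Z) (sym (ren-id t)))
  (λ k → sym (trans (ren-cong (λ _ → refl) (ext^-id (arity c k)) (us k)) (ren-id (us k))))
esf-In-El c As (C ⊃ D) t us = cong (ƛ C) (trans (esf-In-El c As D _ _) (cong (In D) (cases-cong {c} {As = renTy (#∀ D +_) ∘ As} (λ _ → refl)
  (cong (_∙ tvar (at D)) (trans (ren-∘ _ _ id suc t) (ren-cong (λ _ → refl) (+-suc (#⊃ D)) t)))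
  (λ k → let n = arity c k in cong (El n D) (cong₂ _·_
    (trans (ren-∘ _ _ id _ (us k))
           (ren-cong (λ _ → refl) (λ x → trans (ext^-∘ n _ suc x) (ext^-cong n (+-suc (#⊃ D)) x)) (us k)))
    (cong var (trans (ext^-at n _) (cong (n +_) (+-identityʳ (#⊃ D))))))))))
esf-In-El c As (`∀ D) t us = cong Λ (trans (esf-In-El c (renTy suc ∘ As) D _ _) (cong (In D) (cases-cong {c}
  (λ i → trans (renTy-∘ _ suc (As i)) (renTy-cong (+-suc (#∀ D)) (As i)))
  (cong (_∙ tvar (at D)) (trans (ren-∘ _ _ suc id t) (ren-cong (+-suc (#∀ D)) (λ _ → refl) t)))
  (λ k → let n = arity c k in cong (El n D) (cong₂ _∙_
    (trans (ren-∘ _ _ suc id (us k)) (ren-cong (+-suc (#∀ D)) (λ _ → refl) (us k)))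
    (cong tvar (+-identityʳ (#∀ D))))))))

-- The ε-atomization of a type application

-- The application  y⟨w⟩  below the n binders of ⟨w⟩, where y is the variable that
-- has index x outside these binders.
saturate : (n x : ℕ) → Tm
saturate n x = apps (var (n + x)) (vars n)

ren-saturate : ∀ n ρ ξ x → ren ρ (ext^ n ξ) (saturate n x) ≡ saturate n (ξ x)
ren-saturate n ρ ξ x = trans (ren-apps ρ (ext^ n ξ) (var (n + x)) (vars n))
  (cong₂ (λ y us → apps (var y) us) (ext^-+ n ξ x) (ren-vars n ρ ξ))

-- λ⟨yₖ⟩. esf c As B t ⟨yₖ⟨w⟩⟩ₖ,  which is the ε-atomization of a type application
-- to B provided that B is not atomic.
esfApp : (c : Connective) → Vector Ty (I c) → Tm → Ty → Tm
esfApp c As t B =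
  lams (alts c As B) (esf c As B (wk 0 (K c) t) (λ k → saturate (arity c k) (pos k)))

private
  In-El-esfApp : ∀ c As t B →
    lams (alts c As B) (In B (cases c (renTy (#∀ B +_) ∘ As)
      (wk (#∀ B) (#⊃ B + K c) t ∙ tvar (at B))
      (λ k → El (arity c k) B (saturate (arity c k) (#⊃ B + pos k)))))
    ≡ esfApp c As t B
  In-El-esfApp c As t B = cong (lams (alts c As B)) (trans
    (cong (In B) (cases-cong {c} {As = renTy (#∀ B +_) ∘ As} (λ _ → refl)
      (cong (_∙ tvar (at B)) (sym (trans (ren-∘ _ _ id (K c +_) t)
        (ren-cong (λ _ → refl) (λ x → sym (+-assoc (#⊃ B) (K c) x)) t))))
      (λ k → cong (El (arity c k) B) (sym (ren-saturate (arity c k) _ _ (pos k))))))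
    (sym (esf-In-El c As B _ _)))

appε-⊃ : ∀ c As t C D → appε c As t (C ⊃ D) ≡ esfApp c As t (C ⊃ D)
appε-⊃ c As t C D = In-El-esfApp c As t (C ⊃ D)

appε-∀ : ∀ c As t D → appε c As t (`∀ D) ≡ esfApp c As t (`∀ D)
appε-∀ c As t D = In-El-esfApp c As t (`∀ D)

ren-wk : ∀ n ρ ξ t → ren ρ (ext^ n ξ) (wk 0 n t) ≡ wk 0 n (ren ρ ξ t)
ren-wk n ρ ξ t = ren-comm (λ _ → refl) (ext^-+ n ξ) t

ren-alts-lams : ∀ ρ ξ c As B t → ren ρ ξ (lams (alts c As B) t) ≡
  lams (alts c (renTy ρ ∘ As) (renTy ρ B)) (ren ρ (ext^ (K c) ξ) t)
ren-alts-lams ρ ξ c As B t = trans (ren-lams ρ ξ (alts c As B) t (length-alts c As B))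
  (cong (λ Bs → lams Bs (ren ρ (ext^ (K c) ξ) t)) (renTy-alts ρ c As B))

ren-esfApp : ∀ ρ ξ c As t B →
  ren ρ ξ (esfApp c As t B) ≡ esfApp c (renTy ρ ∘ As) (ren ρ ξ t) (renTy ρ B)
ren-esfApp ρ ξ c As t B = trans (ren-alts-lams ρ ξ c As B _)
  (cong (lams (alts c (renTy ρ ∘ As) (renTy ρ B)))
    (trans (ren-esf ρ (ext^ (K c) ξ) c As B _ _)
      (esf-cong (renTy ρ B) (λ _ → refl) (ren-wk (K c) ρ ξ t)
        (λ k → trans (ren-saturate (arity c k) ρ (ext^ (K c) ξ) (pos k))
                     (cong (saturate (arity c k)) (ext^-pos ξ k))))))

ren-appε : ∀ ρ ξ c As t B →
  ren ρ ξ (appε c As t B) ≡ appε c (renTy ρ ∘ As) (ren ρ ξ t) (renTy ρ B)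
ren-appε ρ ξ c As t (tvar Y) = refl
ren-appε ρ ξ c As t (C ⊃ D)  = trans (cong (ren ρ ξ) (appε-⊃ c As t C D))
  (trans (ren-esfApp ρ ξ c As t (C ⊃ D)) (sym (appε-⊃ c _ _ _ _)))
ren-appε ρ ξ c As t (`∀ D)   = trans (cong (ren ρ ξ) (appε-∀ c As t D))
  (trans (ren-esfApp ρ ξ c As t (`∀ D)) (sym (appε-∀ c _ _ _)))

⟶-esfApp : ∀ c As B → t ⟶ u → esfApp c As t B ⟶ esfApp c As u B
⟶-esfApp c As B r = ⟶-lams (alts c As B) (⟶-esf B (⟶-ren r) (λ _ → ⟶-refl))

⟶-appε : ∀ c As B → t ⟶ u → appε c As t B ⟶ appε c As u B
⟶-appε c As (tvar Y) r = ⟶-∙ r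
⟶-appε {t} {u} c As (C ⊃ D) r
  rewrite appε-⊃ c As t C D | appε-⊃ c As u C D = ⟶-esfApp c As (C ⊃ D) r
⟶-appε {t} {u} c As (`∀ D) r
  rewrite appε-∀ c As t D | appε-∀ c As u D = ⟶-esfApp c As (`∀ D) r

-- The central computation: first the abstractions of the yₖ are contracted, then
-- those of every branch, whose arguments are variables.
cases-esfApp : ∀ c As B t us → cases c As (esfApp c As t B) us ⟶ esf c As B t us
cases-esfApp c As B t us =
  ⟶-trans (⟶-reflexive (cong (λ s → apps s branches) (sym (rsub-id (λ _ → refl) (esfApp c As t B)))))
  (⟶-trans (⟶-β* id var (alts c As B) body branches (trans (length-alts c As B) (sym (length-tabulate branch))))
  (⟶-trans (⟶-reflexive substituted)
           (⟶-esf B ⟶-refl (λ k → ⟶-β-vars (hyps c As k) (us k) (length-hyps c As k)))))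
  where
  branch : Vector Tm (K c)
  branch k = lams (hyps c As k) (us k)
  branches : List Tm
  branches = tabulate branch
  body : Tm
  body = esf c As B (wk 0 (K c) t) (λ k → saturate (arity c k) (pos k))
  τ : ℕ → Tm
  τ = env var branches
  function : rsub id τ (wk 0 (K c) t) ≡ t
  function = trans (rsub-ren id τ id (K c +_) t)
    (rsub-id (λ x → env-+ var branches x (length-tabulate branch)) t)
  argument : ∀ k → let n = arity c k in
    rsub id (extTm^ n τ) (saturate n (pos k)) ≡ apps (wk 0 n (branch k)) (vars n)
  argument k = let n = arity c k in
    trans (rsub-apps id (extTm^ n τ) (var (n + pos k)) (vars n))
    (cong₂ apps (trans (extTm^-+ n τ (pos k)) (cong (wk 0 n) (env-pos var branch k)))
                (rsub-vars n id τ))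
  substituted : rsub id τ body ≡
    esf c As B t (λ k → apps (wk 0 (arity c k) (branch k)) (vars (arity c k)))
  substituted = trans (rsub-esf id τ c As B _ _)
    (trans (esf-cong (renTy id B) (renTy-id ∘ As) function argument)
           (cong (λ A → esf c As A t (λ k → apps (wk 0 (arity c k) (branch k)) (vars (arity c k)))) (renTy-id B)))

-- For B atomic both sides are the same term.
cases-appε : ∀ c As B t us → cases c As (appε c As t B) us ⟶ esf c As B t us
cases-appε c As (tvar Y) t us = ⟶-refl
cases-appε c As (C ⊃ D)  t us rewrite appε-⊃ c As t C D = cases-esfApp c As (C ⊃ D) t us
cases-appε c As (`∀ D)   t us rewrite appε-∀ c As t D   = cases-esfApp c As (`∀ D) t us

-- The FF-atomization of a type application

appFF-cong : ∀ {c As Bs t s} B → As ≗ Bs → t ≡ s → appFF c As t B ≡ appFF c Bs s B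
appFF-cong (tvar Y) e refl = refl
appFF-cong {c} (C ⊃ D) e refl = cong₂ lams (alts-cong c e (C ⊃ D))
  (cong (ƛ C) (cases-cong {c} e (appFF-cong D e refl) (λ _ → refl)))
appFF-cong {c} (`∀ D)  e refl = cong₂ lams (alts-cong c e (`∀ D))
  (cong Λ (cases-cong {c} (cong (renTy suc) ∘ e) (appFF-cong D (cong (renTy suc) ∘ e) refl) (λ _ → refl)))

ren-appFF : ∀ ρ ξ c As t B →
  ren ρ ξ (appFF c As t B) ≡ appFF c (renTy ρ ∘ As) (ren ρ ξ t) (renTy ρ B)
ren-appFF ρ ξ c As t (tvar Y) = refl
ren-appFF ρ ξ c As t (C ⊃ D)  = trans (ren-alts-lams ρ ξ c As (C ⊃ D) _)
  (cong (lams (alts c (renTy ρ ∘ As) (renTy ρ (C ⊃ D)))) (cong (ƛ (renTy ρ C))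
    (trans (ren-cases ρ (ext^ (suc (K c)) ξ) c As _ _) (cases-cong {c} {As = renTy ρ ∘ As} (λ _ → refl)
      (trans (ren-appFF ρ (ext^ (suc (K c)) ξ) c As _ D)
             (cong (λ s → appFF c (renTy ρ ∘ As) s (renTy ρ D)) (ren-wk (suc (K c)) ρ ξ t)))
      (λ k → let n = arity c k in cong₂ _·_
        (trans (ren-saturate n ρ _ (suc (pos k))) (cong (saturate n ∘ suc) (ext^-pos ξ k)))
        (cong var (trans (ext^-at n _) (+-identityʳ n))))))))
ren-appFF ρ ξ c As t (`∀ D)   = trans (ren-alts-lams ρ ξ c As (`∀ D) _)
  (cong (lams (alts c (renTy ρ ∘ As) (renTy ρ (`∀ D)))) (cong Λ
    (trans (ren-cases (ext ρ) (ext^ (K c) ξ) c (renTy suc ∘ As) _ _) (cases-cong {c} (λ i → renTy-ext-suc ρ (As i))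
      (trans (ren-appFF (ext ρ) (ext^ (K c) ξ) c (renTy suc ∘ As) _ D)
             (appFF-cong (renTy (ext ρ) D) (λ i → renTy-ext-suc ρ (As i))
               (ren-comm (λ _ → refl) (ext^-+ (K c) ξ) t)))
      (λ k → let n = arity c k in cong (_∙ tvar 0)
        (trans (ren-saturate n (ext ρ) _ (pos k)) (cong (saturate n) (ext^-pos ξ k))))))))

-- The inner occurrence of appFF at D is applied to a list of branches, so that
-- after the induction hypothesis cases-appε applies to it.
appFF⟶appε : ∀ c As t B → appFF c As t B ⟶ appε c As t B
appFF⟶appε c As t (tvar Y) = ⟶-refl
appFF⟶appε c As t (C ⊃ D) rewrite appε-⊃ c As t C D =
  ⟶-lams (alts c As (C ⊃ D)) (⟶-ƛ
    (⟶-trans (⟶-cases {c = c} {As} (appFF⟶appε c As _ D) (λ _ → ⟶-refl))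
    (⟶-trans (cases-appε c As D _ _)
             (⟶-reflexive (esf-cong D (λ _ → refl) (sym (ren-∘ id suc id (K c +_) t))
               (λ k → cong (_· var (arity c k)) (sym (ren-saturate (arity c k) id suc (pos k)))))))))
appFF⟶appε c As t (`∀ D) rewrite appε-∀ c As t D =
  ⟶-lams (alts c As (`∀ D)) (⟶-Λ
    (⟶-trans (⟶-cases {c = c} {renTy suc ∘ As} (appFF⟶appε c (renTy suc ∘ As) _ D) (λ _ → ⟶-refl))
    (⟶-trans (cases-appε c (renTy suc ∘ As) D _ _)
             (⟶-reflexive (esf-cong D (λ _ → refl) (sym (ren-∘ suc id id (K c +_) t))
               (λ k → cong (_∙ tvar 0)
                 (sym (trans (ren-cong (λ _ → refl) (sym ∘ ext^-id (arity c k)) _)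
                             (ren-saturate (arity c k) suc id (pos k))))))))))

-- Atomization of translated terms

module AtomizeProperties
  (app : (c : Connective) → Vector Ty (I c) → Tm → Ty → Tm)
  (ren-app : ∀ ρ ξ c As t B →
    ren ρ ξ (app c As t B) ≡ app c (renTy ρ ∘ As) (ren ρ ξ t) (renTy ρ B))
  where

  open Atomize app

  atomize-renRP : ∀ ρ ξ t → atomize (renRP ρ ξ t) ≡ ren ρ ξ (atomize t)
  atomize-renRP ρ ξ (var x) = refl
  atomize-renRP ρ ξ (ƛ A t) = cong (ƛ (renTy ρ A)) (atomize-renRP ρ (ext ξ) t)
  atomize-renRP ρ ξ (t · u) = cong₂ _·_ (atomize-renRP ρ ξ t) (atomize-renRP ρ ξ u)
  atomize-renRP ρ ξ (Λ t)   = cong Λ (atomize-renRP (ext ρ) ξ t)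
  atomize-renRP ρ ξ (t ∙[ c , As ] B) =
    trans (cong (λ s → app c (renTy ρ ∘ As) s (renTy ρ B)) (atomize-renRP ρ ξ t))
          (sym (ren-app ρ ξ c As (atomize t) B))

  atomize-lamsRP : ∀ As t → atomize (lamsRP As t) ≡ lams As (atomize t)
  atomize-lamsRP []       t = refl
  atomize-lamsRP (A ∷ As) t = cong (ƛ A) (atomize-lamsRP As t)

  atomize-appsRP : ∀ t us → atomize (appsRP t us) ≡ apps (atomize t) (map atomize us)
  atomize-appsRP t []       = refl
  atomize-appsRP t (u ∷ us) = atomize-appsRP (t · u) us

  -- Atomization commutes with the weakening in the translation of ι.
  atomize-ι : ∀ c As k ts → atomize (ι c As k ts *ᵗ) ≡
    Λ (lams (alts c (λ i → renTy suc (As i *)) (tvar 0))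
      (apps (var (pos k)) (tabulate (λ p → wk 1 (K c) (atomize (ts p *ᵗ))))))
  atomize-ι c As k ts = cong Λ (trans (atomize-lamsRP (alts c As′ (tvar 0)) (appsRP (var (pos k)) (tabulate us)))
    (cong (lams (alts c As′ (tvar 0))) (trans (atomize-appsRP (var (pos k)) (tabulate us))
      (cong (apps (var (pos k))) (trans (map-tabulate us atomize)
        (tabulate-cong (λ p → atomize-renRP suc (K c +_) (ts p *ᵗ))))))))
    where
    As′ : Vector Ty (I c)
    As′ i = renTy suc (As i *)
    us : Vector TmRP (arity c k)
    us p = renRP suc (K c +_) (ts p *ᵗ)

  atomize-δ : ∀ c As t ss C → atomize (δ c As t ss C *ᵗ) ≡
    cases c (λ i → As i *) (app c (λ i → As i *) (atomize (t *ᵗ)) (C *)) (λ k → atomize (ss k *ᵗ))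
  atomize-δ c As t ss C = trans (atomize-appsRP (t *ᵗ ∙[ c , As* ] C *) (tabulate branch))
    (cong (apps (app c As* (atomize (t *ᵗ)) (C *))) (trans (map-tabulate branch atomize)
      (tabulate-cong (λ k → atomize-lamsRP (hyps c As* k) (ss k *ᵗ)))))
    where
    As* : Vector Ty (I c)
    As* i = As i *
    branch : Vector TmRP (K c)
    branch k = lamsRP (hyps c As* k) (ss k *ᵗ)

module FF = AtomizeProperties appFF ren-appFF
module Eps = AtomizeProperties appε ren-appε

↓⟶↓ᵋ : ∀ t → t ↓ ⟶ t ↓ᵋ
↓⟶↓ᵋ (var x) = ⟶-refl
↓⟶↓ᵋ (ƛ A t) = ⟶-ƛ (↓⟶↓ᵋ t)
↓⟶↓ᵋ (t · u) = ⟶-· (↓⟶↓ᵋ t) (↓⟶↓ᵋ u)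
↓⟶↓ᵋ (Λ t)   = ⟶-Λ (↓⟶↓ᵋ t)
↓⟶↓ᵋ (t ∙[ c , As ] B) =
  ⟶-trans (appFF⟶appε c As (t ↓) B) (⟶-appε c As B (↓⟶↓ᵋ t))

-- A δ translates to a type application to C* applied to the branches, which
-- cases-appε reduces to the shape of its ESF-translation.
*↓ᵋ⟶♯ : ∀ u → u *ᵗ ↓ᵋ ⟶ u ♯
*↓ᵋ⟶♯ (var x) = ⟶-refl
*↓ᵋ⟶♯ (ƛ A t) = ⟶-ƛ (*↓ᵋ⟶♯ t)
*↓ᵋ⟶♯ (t · u) = ⟶-· (*↓ᵋ⟶♯ t) (*↓ᵋ⟶♯ u)
*↓ᵋ⟶♯ (ι c As k ts) =
  ⟶-trans (⟶-reflexive (Eps.atomize-ι c As k ts))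
    (⟶-Λ (⟶-lams (alts c (λ i → renTy suc (As i *)) (tvar 0))
      (⟶-apps ⟶-refl (Pointwise.tabulate⁺ (λ p → ⟶-ren (*↓ᵋ⟶♯ (ts p)))))))
*↓ᵋ⟶♯ (δ c As t ss C) =
  ⟶-trans (⟶-reflexive (Eps.atomize-δ c As t ss C))
  (⟶-trans (cases-appε c (λ i → As i *) (C *) (t *ᵗ ↓ᵋ) (λ k → ss k *ᵗ ↓ᵋ))
  (⟶-trans (⟶-esf (C *) (*↓ᵋ⟶♯ t) (λ k → *↓ᵋ⟶♯ (ss k)))
           (⟶-reflexive (esf-In-El c (λ i → As i *) (C *) (t ♯) (λ k → ss k ♯)))))

-- Lookup in contexts

∋-map : ∀ {F G : Set} {h : F → G} {Γ x A} → Γ ∋ x ∶ A → map h Γ ∋ x ∶ h A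
∋-map here      = here
∋-map (there d) = there (∋-map d)

∋-map⁻ : ∀ {F G : Set} {h : F → G} {Γ x B} → map h Γ ∋ x ∶ B → ∃ λ A → Γ ∋ x ∶ A × B ≡ h A
∋-map⁻ {Γ = A ∷ Γ} here      = A , here , refl
∋-map⁻ {Γ = A ∷ Γ} (there d) with ∋-map⁻ d
... | B , d′ , e = B , there d′ , e

∋-ʳ++ : ∀ {F : Set} {n} {Γ : List F} {x A} As → length As ≡ n → Γ ∋ x ∶ A → As ʳ++ Γ ∋ n + x ∶ A
∋-ʳ++ []       refl d = d
∋-ʳ++ {Γ = Γ} {x} {A} (B ∷ As) refl d =
  subst (As ʳ++ B ∷ Γ ∋_∶ A) (+-suc (length As) x) (∋-ʳ++ As refl (there d))

∋-head : ∀ {F : Set} {n} {Γ : List F} {A} As → length As ≡ n → As ʳ++ A ∷ Γ ∋ n ∶ A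
∋-head {n = n} {Γ} {A} As e = subst (As ʳ++ A ∷ Γ ∋_∶ A) (+-identityʳ n) (∋-ʳ++ As e here)

∋-pos : ∀ {F : Set} {n} {Γ : List F} (As : Vector F n) k → tabulate As ʳ++ Γ ∋ pos k ∶ As k
∋-pos {n = suc n} {Γ} As zero =
  subst (tabulate (As ∘ suc) ʳ++ As zero ∷ Γ ∋_∶ As zero) (sym (pos-zero n))
    (∋-head (tabulate (As ∘ suc)) (length-tabulate (As ∘ suc)))
∋-pos {n = suc n} {Γ} As (suc k) =
  subst (tabulate (As ∘ suc) ʳ++ As zero ∷ Γ ∋_∶ As (suc k)) (sym (pos-suc k)) (∋-pos (As ∘ suc) k)

-- Typing under renaming and substitution

-- ξ maps the variables of Γ to variables of Δ, up to the type renaming ρ.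
Renaming : (ρ ξ : ℕ → ℕ) → List Ty → List Ty → Set
Renaming ρ ξ Γ Δ = ∀ {x A} → Γ ∋ x ∶ A → Δ ∋ ξ x ∶ renTy ρ A

Renaming-ext : Renaming ρ ξ Γ Δ → Renaming ρ (ext ξ) (A ∷ Γ) (renTy ρ A ∷ Δ)
Renaming-ext r here      = here
Renaming-ext r (there d) = there (r d)

Renaming-Λ : Renaming ρ ξ Γ Δ → Renaming (ext ρ) ξ (map (renTy suc) Γ) (map (renTy suc) Δ)
Renaming-Λ {ρ} {ξ} {Δ = Δ} r {x} d with ∋-map⁻ d
... | A , d′ , refl =
  subst (map (renTy suc) Δ ∋ ξ x ∶_) (sym (renTy-ext-suc ρ A)) (∋-map (r d′))

⊢-ren : Renaming ρ ξ Γ Δ → Γ ⊢at t ∶ A → Δ ⊢at ren ρ ξ t ∶ renTy ρ A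
⊢-ren r (var d) = var (r d)
⊢-ren r (ƛ d)   = ƛ (⊢-ren (Renaming-ext r) d)
⊢-ren r (d · e) = ⊢-ren r d · ⊢-ren r e
⊢-ren r (Λ d)   = Λ (⊢-ren (Renaming-Λ r) d)
⊢-ren {ρ} {ξ} {Δ = Δ} r (_∙_ {A} {t} d Y) =
  subst (Δ ⊢at ren ρ ξ t ∙ tvar (ρ Y) ∶_) (sym (renTy-⟦tvar⟧ ρ A Y)) (⊢-ren r d ∙ ρ Y)

-- Pure term weakening does not change types, although ren renames them by id.
⊢-wk : ∀ {n} → (∀ {x A} → Γ ∋ x ∶ A → Δ ∋ n + x ∶ A) → Γ ⊢at t ∶ A → Δ ⊢at wk 0 n t ∶ A
⊢-wk {Δ = Δ} {t} {A} {n} r d = subst (Δ ⊢at wk 0 n t ∶_) (renTy-id A)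
  (⊢-ren (λ {x} {B} e → subst (Δ ∋ n + x ∶_) (sym (renTy-id B)) (r e)) d)

⊢-subTm : (∀ {x A} → Γ ∋ x ∶ A → Δ ⊢at σ x ∶ A) → Γ ⊢at t ∶ A → Δ ⊢at subTm σ t ∶ A
⊢-subTm h (var d) = h d
⊢-subTm h (ƛ d)   = ƛ (⊢-subTm (λ { here → var here ; (there e) → ⊢-wk there (h e) }) d)
⊢-subTm h (d · e) = ⊢-subTm h d · ⊢-subTm h e
⊢-subTm {Γ} {Δ} {σ} h (Λ d) = Λ (⊢-subTm h′ d)
  where
  h′ : ∀ {x A} → map (renTy suc) Γ ∋ x ∶ A → map (renTy suc) Δ ⊢at wk 1 0 (σ x) ∶ A
  h′ e with ∋-map⁻ e
  ... | A , e′ , refl = ⊢-ren ∋-map (h e′)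
⊢-subTm h (d ∙ Y) = ⊢-subTm h d ∙ Y

⊢-[] : A ∷ Γ ⊢at t ∶ B → Γ ⊢at s ∶ A → Γ ⊢at t [ s ] ∶ B
⊢-[] d e = ⊢-subTm (λ { here → e ; (there x) → var x }) d

-- Subject reduction, which turns untyped reductions into typed ones.
subject-reduction : Γ ⊢at t ∶ A → t ⟶ u → (Γ ⊢at t ⇝ u ∶ A) × (Γ ⊢at u ∶ A)
subject-reduction d ⟶-refl = ⇝-refl d , d
subject-reduction d (⟶-trans r q) with subject-reduction d r
... | r′ , e with subject-reduction e q
...   | q′ , e′ = ⇝-trans r′ q′ , e′
subject-reduction (ƛ d) (⟶-ƛ r) with subject-reduction d r
... | r′ , e = ⇝-ƛ r′ , ƛ e
subject-reduction (d₁ · d₂) (⟶-· r q) with subject-reduction d₁ r | subject-reduction d₂ q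
... | r′ , e₁ | q′ , e₂ = ⇝-· r′ q′ , e₁ · e₂
subject-reduction (Λ d) (⟶-Λ r) with subject-reduction d r
... | r′ , e = ⇝-Λ r′ , Λ e
subject-reduction (d ∙ Y) (⟶-∙ r) with subject-reduction d r
... | r′ , e = ⇝-∙ r′ Y , e ∙ Y
subject-reduction (ƛ d · e) (⟶-β A t s) = β-⊃ d e , ⊢-[] d e

-- Typing of the FF-atomization

⊢-lams : ∀ As → As ʳ++ Γ ⊢at t ∶ B → Γ ⊢at lams As t ∶ As ⊃* B
⊢-lams []       d = d
⊢-lams (A ∷ As) d = ƛ (⊢-lams As d)

⊢-apps : ∀ {As us} → Γ ⊢at t ∶ As ⊃* B → Pointwise (Γ ⊢at_∶_) us As → Γ ⊢at apps t us ∶ B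
⊢-apps d []       = d
⊢-apps d (e ∷ es) = ⊢-apps (d · e) es

⊢-vars : ∀ {n} As → length As ≡ n → Pointwise (As ʳ++ Γ ⊢at_∶_) (vars n) As
⊢-vars []       refl = []
⊢-vars (A ∷ As) refl = var (∋-head As refl) ∷ ⊢-vars As refl

⊢-saturate : ∀ {n x} As → length As ≡ n → Γ ∋ x ∶ As ⊃* B → As ʳ++ Γ ⊢at saturate n x ∶ B
⊢-saturate As e d = ⊢-apps (var (∋-ʳ++ As e d)) (⊢-vars As e)

Pointwise-tabulate : ∀ {ℓ} {X Y Z : Set} {R : X → Y → Set ℓ} (h : Z → Y) zs {us : Vector X (length zs)} →
  (∀ p → R (us p) (h (lookup zs p))) → Pointwise R (tabulate us) (map h zs)
Pointwise-tabulate h []       r = []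
Pointwise-tabulate h (z ∷ zs) r = r zero ∷ Pointwise-tabulate h zs (r ∘ suc)

⊢-cases : ∀ c As {us} → Γ ⊢at t ∶ alts c As B ⊃* B → (∀ k → hyps c As k ʳ++ Γ ⊢at us k ∶ B) →
  Γ ⊢at cases c As t us ∶ B
⊢-cases c As d e = ⊢-apps d (Pointwise.tabulate⁺ (λ k → ⊢-lams (hyps c As k) (e k)))

-- The type of the result is the instance of RPbody c As at B, obtained although
-- only instances at type variables are derivable by type application.
⊢-appFF : ∀ c As B → Γ ⊢at t ∶ `∀ (RPbody c As) → Γ ⊢at appFF c As t B ∶ alts c As B ⊃* B
⊢-appFF {Γ} {t} c As (tvar Y) d = subst (Γ ⊢at t ∙ tvar Y ∶_) (RPbody-⟦tvar⟧ c As Y) (d ∙ Y)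
⊢-appFF c As (C ⊃ D) d = ⊢-lams (alts c As (C ⊃ D)) (ƛ (⊢-cases c As
  (⊢-appFF c As D (⊢-wk (there ∘ ∋-ʳ++ (alts c As (C ⊃ D)) (length-alts c As (C ⊃ D))) d))
  (λ k → ⊢-saturate (hyps c As k) (length-hyps c As k) (there (∋-pos _ k))
         · var (∋-head (hyps c As k) (length-hyps c As k)))))
⊢-appFF {Γ} {t} c As (`∀ D) d = ⊢-lams (alts c As (`∀ D)) (Λ (⊢-cases c As′
  (⊢-appFF c As′ D (subst (Θ ⊢at wk 1 (K c) t ∶_) (renTy-RPbody suc c As)
    (⊢-ren (∋-map ∘ ∋-ʳ++ (alts c As (`∀ D)) (length-alts c As (`∀ D))) d)))
  branch))
  where
  As′ : Vector Ty (I c)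
  As′ = renTy suc ∘ As
  Θ : List Ty
  Θ = map (renTy suc) (alts c As (`∀ D) ʳ++ Γ)
  ∀D-inst : renTy (ext suc) D ⟦ tvar 0 ⟧ ≡ D
  ∀D-inst = trans (⟦tvar⟧ (renTy (ext suc) D) 0)
    (trans (renTy-∘ (instVar 0) (ext suc) D)
    (trans (renTy-cong (λ { zero → refl ; (suc X) → refl }) D) (renTy-id D)))
  branch : ∀ k → hyps c As′ k ʳ++ Θ ⊢at saturate (arity c k) (pos k) ∙ tvar 0 ∶ D
  branch k = subst (hyps c As′ k ʳ++ Θ ⊢at saturate (arity c k) (pos k) ∙ tvar 0 ∶_) ∀D-inst
    (⊢-saturate (hyps c As′ k) (length-hyps c As′ k)
      (subst (Θ ∋ pos k ∶_) (renTy-hyps suc c As k (`∀ D)) (∋-map (∋-pos _ k))) ∙ 0)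

⊢-*↓ : ∀ {Γ u A} → Γ ⊢ᵖ u ∶ A → map _* Γ ⊢at u *ᵗ ↓ ∶ A *
⊢-*↓ (var d) = var (∋-map d)
⊢-*↓ (ƛ d)   = ƛ (⊢-*↓ d)
⊢-*↓ (d · e) = ⊢-*↓ d · ⊢-*↓ e
⊢-*↓ {Γ} (ι {c} {As} {k} {ts} ds) =
  subst (map _* Γ ⊢at_∶ † c As *) (sym (FF.atomize-ι c As k ts))
    (Λ (⊢-lams (alts c As′ (tvar 0)) (⊢-apps {As = hyps c As′ k} (var (∋-pos _ k))
      (Pointwise-tabulate (As′ ∘ f c) (fibre c k) (λ p →
        ⊢-ren (∋-ʳ++ (alts c As′ (tvar 0)) (length-alts c As′ (tvar 0)) ∘ ∋-map) (⊢-*↓ (ds p)))))))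
  where
  As′ : Vector Ty (I c)
  As′ i = renTy suc (As i *)
⊢-*↓ {Γ} (δ {c} {As} {t} {ss} {C} d ds) =
  subst (map _* Γ ⊢at_∶ C *) (sym (FF.atomize-δ c As t ss C))
    (⊢-cases c As* (⊢-appFF c As* (C *) (⊢-*↓ d)) (λ k →
      subst (_⊢at ss k *ᵗ ↓ ∶ C *) (context k) (⊢-*↓ (ds k))))
  where
  As* : Vector Ty (I c)
  As* i = As i *
  context : ∀ k → map _* (hyps c As k ʳ++ Γ) ≡ hyps c As* k ʳ++ map _* Γ
  context k = trans (map-ʳ++ _* (hyps c As k)) (cong (_ʳ++ map _* Γ) (map-hyps c _* As k))

proposition16 : (Γ : List Tyᵖ) (A : Tyᵖ) (u : Tmᵖ) → Γ ⊢ᵖ u ∶ A →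
    (map _* Γ ⊢at (u *ᵗ) ↓ ⇝ (u *ᵗ) ↓ᵋ ∶ A *)
    × (map _* Γ ⊢at (u *ᵗ) ↓ᵋ ⇝ u ♯ ∶ A *)
proposition16 Γ A u d with subject-reduction (⊢-*↓ d) (↓⟶↓ᵋ (u *ᵗ))
... | r , e = r , proj₁ (subject-reduction e (*↓ᵋ⟶♯ u))
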